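{- Let $\lambda$ be a partition and $\pi$ a reverse plane partition of shape $\lambda$. Define $\pi_1=\pi$ and, as long as $\pi_i$ is not the zero reverse plane partition, let $v_i$ be the minimum of $\mathrm{cand}(\pi_i)$ with respect to the content order, $h_i=h(v_i,\pi_i)$ and $\pi_{i+1}=\pi_i-Q(v_i,\pi_i)$; let $\pi_{s+1}$ be the first reverse plane partition in this sequence with only zero entries. Then $h_i\le h_{i+1}$ for all $i\in[s-1]$ and $\pi=h_1*h_2*\cdots*h_s*0$.
   Context: Cells are pairs $(i,j)\in\mathbb Z^2$; $\mathrm n(i,j)=(i-1,j)$, $\mathrm e(i,j)=(i,j+1)$, $\mathrm s(i,j)=(i+1,j)$, $\mathrm w(i,j)=(i,j-1)$. A partition $\lambda$ is identified with its Young diagram; $\lambda'$ is its conjugate. A reverse plane partition of shape $\lambda$ is $\pi:\lambda\to\mathbb N$ with $\pi(u)\le\pi(\mathrm e u),\pi(\mathrm s u)$, with conventions $\pi(i,j)=0$ if $i\le0$ or $j\le0$, $\pi(i,j)=\infty$ if $i,j\ge1$, $(i,j)\notin\lambda$; $0$ denotes the zero reverse plane partition. Content $c(i,j)=j-i$; outer corner: $u\in\lambda$, $\mathrm e u,\mathrm s u\notin\lambda$; inner corner: $\mathrm e u,\mathrm s u\in\lambda$, $\mathrm e\mathrm s u\notin\lambda$. With inner corner contents $i_1<\dots<i_r$ and outer corner contents $o_1<\dots<o_{r+1}$ (interlacing), $\mathcal I=\{u\in\lambda:c(u)=i_k\}$, $\mathcal O=\{u\in\lambda:c(u)=o_k\}$,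 $\mathcal A=\{u\in\lambda:c(u)<o_1\text{ or }i_k<c(u)<o_{k+1}\text{ for some }k\in[r]\}$, $\mathcal B=\{u\in\lambda:o_k<c(u)<i_k\text{ for some }k\in[r]\text{ or }c(u)>o_{r+1}\}$. Content order: $(i,j)\trianglelefteq(k,l)$ iff $j-i>l-k$, or $j-i=l-k$ and $i\ge k$. Candidates: $\mathrm{cand}(\pi)=\{u\in\mathcal O:\pi(u)>\pi(\mathrm w u)\}\cup\{u\in\mathcal A:\pi(u)>\pi(\mathrm w u),\pi(u)>\pi(\mathrm n u)\}$ (nonempty when $\pi\neq0$). North-east path: $(u_0,\dots,u_s)$ in $\lambda$, $u_k\in\{\mathrm n u_{k-1},\mathrm e u_{k-1}\}$, length $s$, head $\alpha=u_0$, tail $\omega=u_s$. South-west path: $(v_0,\dots,v_s)$, $v_k\in\{\mathrm s v_{k-1},\mathrm w v_{k-1}\}$, length $s$, $\alpha=v_s$, $\omega=v_0$. Rim-hook: north-east path $h$ with $\mathrm s\alpha(h)\notin\lambda$, $\mathrm e\omega(h)\notin\lambda$, $\mathrm e\mathrm s u\notin\lambda$ for all $u\in h$; for $u=(i,j)\in\lambda$, $h^u$ is the rim-hook from $(\lambda'_j,j)$ to $(i,\lambda_i)$, and these are all rim-hooks. Reverse lexicographic order on cells: $(i,j)\le(k,l)$ iff $j>l$, or $j=l$ and $i\ge k$; rim-hooks ordered by $h^u\le h^v$ iff $u\le v$. $(\pi\pm P)(u)=\pi(u)\pm1$ for $u\in P$, else $\pi(u)$. $(P,\pi)$ compatible: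 $u\in P\cap(\mathcal I\cup\mathcal A)$ implies $\mathrm e u\in P$ and $\pi(u)=\pi(\mathrm e u)$; $u,\mathrm s u\in P$ implies $\pi(u)=\pi(\mathrm s u)$. $h$ inserts into $\pi$ if some path $P$ has $\omega(P)=\omega(h)$, $\ell(P)=\ell(h)$, $(P,\pi)$ compatible and $\pi+P$ a reverse plane partition; then $h*\pi=\pi+P(h,\pi)$, with $P(h,\pi)$ the south-west path starting at $\omega(h)$ which, while its length is less than $\ell(h)$, moves from current cell $u$ to $\mathrm s u$ if $u\in\mathcal B\cup\mathcal I$ and $\pi(u)=\pi(\mathrm s u)$, and to $\mathrm w u$ otherwise. Iterated insertion is read right to left. For $v\in\mathrm{cand}(\pi)$, $Q(v,\pi)$ is the north-east path starting at $v$ which, from current cell $u$, moves to $\mathrm n u$ if $u\in\mathcal O\cup\mathcal B$ and $\pi(u)=\pi(\mathrm n u)$; to $\mathrm e u$ if $u\in\mathcal I\cup\mathcal A$, or if $\mathrm e u\in\lambda$ and $\pi(u)>\pi(\mathrm n u)$; and terminates if $\pi(u)>\pi(\mathrm n u)$ and $\mathrm e u\notin\lambda$. $h(v,\pi)$ is the rim-hook with $\omega(h(v,\pi))=\omega(Q(v,\pi))$ and $\ell(h(v,\pi))=\ell(Q(v,\pi))$. -}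

module Defs where

open import Data.Nat as ℕ using (ℕ; zero; suc; _≤_; _<_; _≥_; _∸_; _≤?_; _+_)
open import Data.Nat.Properties using () renaming (_≟_ to _≟ℕ_)
open import Data.Integer as ℤ using (ℤ; _⊖_)
open import Data.Product using (Σ; _×_; _,_; ∃)
open import Data.Product.Properties using (≡-dec)
open import Data.Sum using (_⊎_)
open import Data.Maybe using (Maybe; just; nothing)
open import Data.Unit using (⊤)
open import Data.Empty using (⊥)
open import Data.Bool using (if_then_else_)
open import Data.List using (List; []; _∷_; length; filter; map; concatMap; upTo; reverse; zip; drop; head; last)
open import Data.List.Membership.Propositional using (_∈_)
open import Data.List.Relation.Unary.Any using (any?)
open import Data.List.Relation.Unary.Linked using (Linked)
open import Relation.Nullary using (¬_; Dec; yes; no; does)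
open import Relation.Nullary.Decidable using (_×-dec_; ¬?)
open import Relation.Binary.PropositionalEquality using (_≡_)

-- A cell (i , j) : row i, column j.  Cells of a diagram have i , j ≥ 1;
-- cells with a zero coordinate play the role of the paper's cells with
-- i ≤ 0 or j ≤ 0 (only ever reached via n / w from a cell of λ).
Cell : Set
Cell = ℕ × ℕ

n e s w : Cell → Cell
n (i , j) = (i ∸ 1 , j)
e (i , j) = (i , suc j)
s (i , j) = (suc i , j)
w (i , j) = (i , j ∸ 1)

_≟c_ : (u v : Cell) → Dec (u ≡ v)
_≟c_ = ≡-dec _≟ℕ_ _≟ℕ_

Partition : Set
Partition = List ℕ

IsPartition : Partition → Set
IsPartition la = Linked _≥_ la

-- λ_i (1-indexed; 0 outside the range)
part : Partition → ℕ → ℕ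
part []       _             = 0
part (x ∷ xs) zero          = 0
part (x ∷ xs) (suc zero)    = x
part (x ∷ xs) (suc (suc i)) = part xs (suc i)

conjPart : Partition → ℕ → ℕ
conjPart la j = length (filter (j ≤?_) la)

_∈λ_ : Cell → Partition → Set
(i , j) ∈λ la = (1 ≤ i) × (1 ≤ j) × (j ≤ part la i)

_∈λ?_ : (u : Cell) → (la : Partition) → Dec (u ∈λ la)
(i , j) ∈λ? la = (1 ≤? i) ×-dec ((1 ≤? j) ×-dec (j ≤? part la i))

cells : Partition → List Cell
cells la = concatMap (λ i → map (λ j → (i , j)) (map suc (upTo (part la i))))
                     (map suc (upTo (length la)))

content : Cell → ℤ
content (i , j) = j ⊖ i

IsOuter : Partition → Cell → Set
IsOuter la u = u ∈λ la × ¬ (e u ∈λ la) × ¬ (s u ∈λ la)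

IsInner : Partition → Cell → Set
IsInner la u = e u ∈λ la × s u ∈λ la × ¬ (e (s u) ∈λ la)

isOuter? : (la : Partition) → (u : Cell) → Dec (IsOuter la u)
isOuter? la u = (u ∈λ? la) ×-dec (¬? (e u ∈λ? la) ×-dec ¬? (s u ∈λ? la))

isInner? : (la : Partition) → (u : Cell) → Dec (IsInner la u)
isInner? la u = (e u ∈λ? la) ×-dec ((s u ∈λ? la) ×-dec ¬? (e (s u) ∈λ? la))

-- Inner corners are cells of λ (e u ∈ λ implies u ∈ λ), so they are found
-- among `cells la`.  Listing rows top to bottom gives strictly decreasing
-- contents, hence `reverse` gives o₁ < ⋯ < o_{r+1} and i₁ < ⋯ < i_r.
outerContents : Partition → List ℤ
outerContents la = reverse (map content (filter (isOuter? la) (cells la)))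

innerContents : Partition → List ℤ
innerContents la = reverse (map content (filter (isInner? la) (cells la)))

InI : Partition → Cell → Set
InI la u = u ∈λ la × content u ∈ innerContents la

InO : Partition → Cell → Set
InO la u = u ∈λ la × content u ∈ outerContents la

InA : Partition → Cell → Set
InA la u = u ∈λ la ×
  ( (Σ ℤ λ o → head (outerContents la) ≡ just o × content u ℤ.< o)
  ⊎ (Σ (ℤ × ℤ) λ { (a , b) →
       (a , b) ∈ zip (innerContents la) (drop 1 (outerContents la))
       × a ℤ.< content u × content u ℤ.< b }) )

InB : Partition → Cell → Set
InB la u = u ∈λ la ×
  ( (Σ (ℤ × ℤ) λ { (a , b) →
       (a , b) ∈ zip (outerContents la) (innerContents la)
       × a ℤ.< content u × content u ℤ.< b })
  ⊎ (Σ ℤ λ o → last (outerContents la) ≡ just o × o ℤ.< content u) )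

-- A filling of the plane; only its values on cells of λ matter.
Filling : Set
Filling = Cell → ℕ

ℕ∞ : Set
ℕ∞ = Maybe ℕ

_<∞_ : ℕ∞ → ℕ∞ → Set
just a  <∞ just b  = a < b
just _  <∞ nothing = ⊤
nothing <∞ _       = ⊥

_≤∞_ : ℕ∞ → ℕ∞ → Set
just a  ≤∞ just b  = a ≤ b
_       ≤∞ nothing = ⊤
nothing ≤∞ just _  = ⊥

val : Partition → Filling → Cell → ℕ∞
val la π (zero , j)  = just 0
val la π (suc i , zero) = just 0
val la π (suc i , suc j) with (suc i , suc j) ∈λ? la
... | yes _ = just (π (suc i , suc j))
... | no  _ = nothing

IsRPP : Partition → Filling → Set
IsRPP la π = ∀ u → u ∈λ la →
  (val la π u ≤∞ val la π (e u)) × (val la π u ≤∞ val la π (s u))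

IsZero : Partition → Filling → Set
IsZero la π = ∀ u → u ∈λ la → π u ≡ 0

_≈[_]_ : Filling → Partition → Filling → Set
π ≈[ la ] ρ = ∀ u → u ∈λ la → π u ≡ ρ u

zeroRPP : Filling
zeroRPP _ = 0

_+P_ : Filling → List Cell → Filling
(π +P P) u = if does (any? (_≟c u) P) then suc (π u) else π u

_-P_ : Filling → List Cell → Filling
(π -P P) u = if does (any? (_≟c u) P) then π u ∸ 1 else π u

data SWPath (la : Partition) : List Cell → Set where
  sw-one  : ∀ {u} → u ∈λ la → SWPath la (u ∷ [])
  sw-s    : ∀ {u P} → u ∈λ la → SWPath la (s u ∷ P) → SWPath la (u ∷ s u ∷ P)
  sw-w    : ∀ {u P} → u ∈λ la → SWPath la (w u ∷ P) → SWPath la (u ∷ w u ∷ P)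

pathLength : List Cell → ℕ
pathLength P = length P ∸ 1

-- Rim-hooks, indexed by cells: h^u for u = (i , j) ∈ λ is the rim-hook
-- from α = (λ'_j , j) to ω = (i , λ_i).

hookTail : Partition → Cell → Cell
hookTail la (i , j) = (i , part la i)

hookHead : Partition → Cell → Cell
hookHead la (i , j) = (conjPart la j , j)

-- length of a north-east path from α to ω
hookLength : Partition → Cell → ℕ
hookLength la (i , j) = (conjPart la j ∸ i) + (part la i ∸ j)

_≤rl_ : Cell → Cell → Set
(i , j) ≤rl (k , l) = (j ℕ.> l) ⊎ ((j ≡ l) × (i ≥ k))

_⊴_ : Cell → Cell → Set
u ⊴ v = (content u ℤ.> content v) ⊎ ((content u ≡ content v) × (Data.Product.proj₁ u ≥ Data.Product.proj₁ v))

Compatible : Partition → List Cell → Filling → Set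
Compatible la P π =
  (∀ u → u ∈ P → (InI la u ⊎ InA la u) → (e u ∈ P) × (val la π u ≡ val la π (e u)))
  × (∀ u → u ∈ P → s u ∈ P → val la π u ≡ val la π (s u))

InsertsInto : Partition → Cell → Filling → Set
InsertsInto la h π = Σ (List Cell) λ P →
  SWPath la P × head P ≡ just (hookTail la h) × pathLength P ≡ hookLength la h
  × Compatible la P π × IsRPP la (π +P P)

data PPath (la : Partition) (π : Filling) : Cell → ℕ → List Cell → Set where
  p-stop : ∀ {u} → u ∈λ la → PPath la π u 0 (u ∷ [])
  p-s    : ∀ {u k P} → u ∈λ la →
           ((InB la u ⊎ InI la u) × (val la π u ≡ val la π (s u))) →
           PPath la π (s u) k P → PPath la π u (suc k) (u ∷ P)
  p-w    : ∀ {u k P} → u ∈λ la →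
           ¬ ((InB la u ⊎ InI la u) × (val la π u ≡ val la π (s u))) →
           PPath la π (w u) k P → PPath la π u (suc k) (u ∷ P)

-- ρ = h^u * π  (defined only if h^u inserts into π)
Insert : Partition → Cell → Filling → Filling → Set
Insert la h π ρ = InsertsInto la h π ×
  Σ (List Cell) λ P → PPath la π (hookTail la h) (hookLength la h) P × (ρ ≈[ la ] (π +P P))

data IterInsert (la : Partition) : List Cell → Filling → Set where
  ii-nil  : ∀ {π} → π ≈[ la ] zeroRPP → IterInsert la [] π
  ii-cons : ∀ {h hs ρ π} → IterInsert la hs ρ → Insert la h ρ π →
            IterInsert la (h ∷ hs) π

Cand : Partition → Filling → Cell → Set
Cand la π u =
  (InO la u × (val la π u >∞ val la π (w u)))
  ⊎ (InA la u × (val la π u >∞ val la π (w u)) × (val la π u >∞ val la π (n u)))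
  where
  _>∞_ : ℕ∞ → ℕ∞ → Set
  a >∞ b = b <∞ a

data QPath (la : Partition) (π : Filling) : Cell → List Cell → Set where
  q-n    : ∀ {u P} → u ∈λ la →
           (InO la u ⊎ InB la u) → val la π u ≡ val la π (n u) →
           QPath la π (n u) P → QPath la π u (u ∷ P)
  q-e    : ∀ {u P} → u ∈λ la →
           ((InI la u ⊎ InA la u) ⊎ (e u ∈λ la × (val la π (n u) <∞ val la π u))) →
           QPath la π (e u) P → QPath la π u (u ∷ P)
  q-stop : ∀ {u} → u ∈λ la →
           val la π (n u) <∞ val la π u → ¬ (e u ∈λ la) →
           QPath la π u (u ∷ [])

-- the run of the extraction procedure starting at π, producing the list
-- of rim-hooks h₁ ∷ h₂ ∷ ⋯ ∷ h_s (each h_i = h^{u_i} given by its index cell)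
data Run (la : Partition) : Filling → List Cell → Set where
  run-done : ∀ {π} → IsZero la π → Run la π []
  run-step : ∀ {π v Q h hs} →
             ¬ IsZero la π →
             Cand la π v → (∀ u → Cand la π u → v ⊴ u) →
             QPath la π v Q →
             h ∈λ la → last Q ≡ just (hookTail la h) →
             pathLength Q ≡ hookLength la h →
             Run la (π -P Q) hs →
             Run la π (h ∷ hs)

{-# OPTIONS --safe #-}
-- Let v be the minimal candidate.  Whenever the rim leaves a diagonal of content ≥ c(v) eastwards, π is
-- constant along every horizontal edge from that diagonal to the next one: a cell with π(x) > π(w x) that is
-- not a candidate satisfies π(x) = π(n x) > π(w n x), so the failure would propagate north until it met a
-- candidate.  Consequently π(n w u) < π(u) holds along Q, which makes Q move north exactly where
-- π(u) = π(n u).  This shows that π - Q is again a reverse plane partition and that the insertion path of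
-- h(v,π) into π - Q retraces Q.  The same flatness shows that the next minimal candidate has no larger
-- content, and if the content is the same then it lies weakly north-west of v and the next path stays weakly
-- north-west of Q, which gives the order of the rim-hooks.
module Submission where

open import Defs
open import Data.Nat using (ℕ; zero; suc; _≤_; _<_; _∸_; _≤?_; _+_; z≤n; s≤s)
import Data.Nat.Properties as ℕ
open import Data.Nat.ListAction using (sum)
open import Data.Nat.Solver using (module +-*-Solver)
open import Data.Integer as ℤ using (ℤ; _⊖_; +_)
import Data.Integer.Properties as ℤ
open import Algebra.Properties.CommutativeSemigroup ℕ.+-commutativeSemigroup using (x∙yz≈y∙xz)
open import Data.Product using (Σ; ∃; ∃₂; _×_; _,_; proj₁; proj₂)
open import Data.Sum using (_⊎_; inj₁; inj₂)
open import Data.Maybe using (just; nothing)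
open import Data.Maybe.Properties using (just-injective)
open import Data.Empty using (⊥; ⊥-elim)
open import Data.List using (List; []; _∷_; [_]; _++_; length; filter; map; concatMap; upTo; applyUpTo; reverse; zip; drop; head; last)
open import Data.List.Properties using (filter-accept; filter-reject; filter-++; map-++; reverse-++; map-upTo; map-applyUpTo; ++-identityʳ)
open import Data.List.Membership.Propositional using (_∈_; lose)
open import Data.List.Membership.Propositional.Properties using (∈-map⁺; ∈-map⁻; ∈-filter⁻; ∈-upTo⁺; ∈-concatMap⁺)
open import Data.List.Membership.DecPropositional _≟c_ using (_∈?_)
open import Data.List.Relation.Unary.Any as Any using (here; there; any?)
open import Data.List.Relation.Unary.Any.Properties using (reverse⁻)
open import Data.List.Relation.Unary.Linked as Linked using (Linked; []; [-]; _∷_)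
open import Function using (_∘_)
open import Relation.Nullary using (¬_; Dec; yes; no; contradiction)
open import Relation.Unary using (Decidable)
open import Relation.Binary using (tri<; tri≈; tri>)
open import Relation.Binary.PropositionalEquality using (_≡_; refl; sym; trans; cong; cong₂; subst; subst₂; module ≡-Reasoning)

-- The classes O, I, A and B are given through sorted lists of corner contents, which are awkward to
-- reason with. The lists serve only to replace each class by two bits: whether the rim enters, and
-- whether it leaves, its cell of that content by an east or a north step. Then O is east-north, I
-- north-east, A east-east and B north-north. Candidates lie on diagonals entered eastwards, south
-- moves of an insertion start on diagonals entered northwards, and the forced east moves of Q start
-- on diagonals left eastwards. The two halves of the minimality of v do different work: maximal
-- content gives the flatness, and the lowest row on that diagonal settles ties between successive
-- extractions. The order of the rim-hooks becomes accessible because c(v) determines the column of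
-- the cell indexing h(v,π), while its row is the row in which Q ends.

⊖-shift : ∀ a b c → (a ⊖ b) ℤ.+ + (b + c) ≡ + (a + c)
⊖-shift a b c = begin
  (a ⊖ b) ℤ.+ + (b + c)    ≡⟨ ℤ.distribˡ-⊖-+-pos (b + c) a b ⟩
  (a + (b + c)) ⊖ b        ≡⟨ cong₂ _⊖_ (x∙yz≈y∙xz a b c) (sym (ℕ.+-identityʳ b)) ⟩
  (b + (a + c)) ⊖ (b + 0)  ≡⟨ ℤ.+-cancelˡ-⊖ b (a + c) 0 ⟩
  + (a + c)                ∎
  where open ≡-Reasoning

⊖-shift′ : ∀ b c d → (c ⊖ d) ℤ.+ + (b + d) ≡ + (c + b)
⊖-shift′ b c d = trans (cong (λ k → (c ⊖ d) ℤ.+ + k) (ℕ.+-comm b d)) (⊖-shift c d b)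

-- Adding `b + d` to both sides clears both subtractions, so comparisons of contents become
-- comparisons of natural numbers.
⊖-≤⁻ : ∀ a b c d → a ⊖ b ℤ.≤ c ⊖ d → a + d ≤ c + b
⊖-≤⁻ a b c d le = ℤ.drop‿+≤+
  (subst (ℤ._≤ + (c + b)) (⊖-shift a b d)
    (subst ((a ⊖ b) ℤ.+ + (b + d) ℤ.≤_) (⊖-shift′ b c d) (ℤ.+-monoˡ-≤ (+ (b + d)) le)))

⊖-<⁻ : ∀ a b c d → a ⊖ b ℤ.< c ⊖ d → a + d < c + b
⊖-<⁻ a b c d lt = ℤ.drop‿+<+
  (subst (ℤ._< + (c + b)) (⊖-shift a b d)
    (subst ((a ⊖ b) ℤ.+ + (b + d) ℤ.<_) (⊖-shift′ b c d) (ℤ.+-monoˡ-< (+ (b + d)) lt)))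

⊖-≤⁺ : ∀ a b c d → a + d ≤ c + b → a ⊖ b ℤ.≤ c ⊖ d
⊖-≤⁺ a b c d le = ℤ.≮⇒≥ (λ lt → ℕ.<⇒≱ (⊖-<⁻ c d a b lt) le)

⊖-<⁺ : ∀ a b c d → a + d < c + b → a ⊖ b ℤ.< c ⊖ d
⊖-<⁺ a b c d lt = ℤ.≰⇒> (λ le → ℕ.<⇒≱ lt (⊖-≤⁻ c d a b le))

⊖-≡⁻ : ∀ a b c d → a ⊖ b ≡ c ⊖ d → a + d ≡ c + b
⊖-≡⁻ a b c d eq = ℕ.≤-antisym (⊖-≤⁻ a b c d (ℤ.≤-reflexive eq)) (⊖-≤⁻ c d a b (ℤ.≤-reflexive (sym eq)))

-- Rim steps are witnessed by natural column numbers; this recovers the column in row `m` from an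
-- integer content, the bound ruling out negative columns.
⊖-lower : ∀ a m d → a ⊖ m ℤ.≤ d → ∃ λ j → a ≤ j × j ⊖ m ≡ d
⊖-lower a m d le = k + a , ℕ.m≤n+m a k , (begin
  (k + a) ⊖ m                            ≡⟨ ℤ.distribʳ-⊖-+-pos k a m ⟨
  + k ℤ.+ (a ⊖ m)                        ≡⟨ cong (ℤ._+ (a ⊖ m)) (ℤ.0≤i⇒+∣i∣≡i (ℤ.i≤j⇒0≤j-i le)) ⟩
  (d ℤ.- (a ⊖ m)) ℤ.+ (a ⊖ m)            ≡⟨ ℤ.+-assoc d (ℤ.- (a ⊖ m)) (a ⊖ m) ⟩
  d ℤ.+ (ℤ.- (a ⊖ m) ℤ.+ (a ⊖ m))        ≡⟨ cong (λ x → d ℤ.+ x) (ℤ.+-inverseˡ (a ⊖ m)) ⟩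
  d ℤ.+ + 0                              ≡⟨ ℤ.+-identityʳ d ⟩
  d                                      ∎)
  where
  open ≡-Reasoning
  k = ℤ.∣ d ℤ.- (a ⊖ m) ∣

pred< : ∀ d → ℤ.pred d ℤ.< d
pred< d = ℤ.i≤pred[j]⇒i<j ℤ.≤-refl

<suc : ∀ d → d ℤ.< ℤ.suc d
<suc d = ℤ.suc[i]≤j⇒i<j ℤ.≤-refl

content-e : ∀ u → content (e u) ≡ ℤ.suc (content u)
content-e (i , j) = sym (ℤ.distribʳ-⊖-+-pos 1 j i)

content-n : ∀ u → 1 ≤ proj₁ u → content (n u) ≡ ℤ.suc (content u)
content-n (suc i , j) _ = trans (sym (ℤ.[1+m]⊖[1+n]≡m⊖n j i)) (content-e (suc i , j))

content-s : ∀ u → content (s u) ≡ ℤ.pred (content u)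
content-s (i , j) = trans (sym (ℤ.pred-suc _)) (cong ℤ.pred (sym (content-n (suc i , j) (s≤s z≤n))))

content-w : ∀ u → 1 ≤ proj₂ u → content (w u) ≡ ℤ.pred (content u)
content-w (i , suc j) _ = trans (sym (ℤ.pred-suc _)) (cong ℤ.pred (sym (content-e (i , j))))

same-diagonal : ∀ {u v} → content u ≡ content v → proj₁ u ≡ proj₁ v → u ≡ v
same-diagonal {i , j} {.i , l} eq refl =
  cong (i ,_) (ℕ.+-cancelʳ-≡ i j l (⊖-≡⁻ j i l i eq))

module _ {A : Set} {P : A → Set} (P? : Decidable P) where

  filter-applyUpTo-none : ∀ (f : ℕ → A) k → (∀ t → t < k → ¬ P (f t)) → filter P? (applyUpTo f k) ≡ []
  filter-applyUpTo-none f zero    none = refl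
  filter-applyUpTo-none f (suc k) none = trans (filter-reject P? (none 0 (s≤s z≤n)))
    (filter-applyUpTo-none (f ∘ suc) k (λ t lt → none (suc t) (s≤s lt)))

  filter-applyUpTo-unique : ∀ (f : ℕ → A) k t → t < k → P (f t) → (∀ r → P (f r) → r ≡ t) →
    filter P? (applyUpTo f k) ≡ [ f t ]
  filter-applyUpTo-unique f (suc k) zero    lt Pt uniq = trans (filter-accept P? Pt)
    (cong (f 0 ∷_) (filter-applyUpTo-none (f ∘ suc) k (λ r _ Pr → ℕ.1+n≢0 (uniq (suc r) Pr))))
  filter-applyUpTo-unique f (suc k) (suc t) (s≤s lt) Pt uniq =
    trans (filter-reject P? (λ P0 → ℕ.1+n≢0 (sym (uniq 0 P0))))
      (filter-applyUpTo-unique (f ∘ suc) k t lt Pt (λ r Pr → ℕ.suc-injective (uniq (suc r) Pr)))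

range : ℕ → ℕ → List ℕ
range m zero    = []
range m (suc k) = m ∷ range (suc m) k

applyUpTo≡range : ∀ f m k → (∀ t → f t ≡ m + t) → applyUpTo f k ≡ range m k
applyUpTo≡range f m zero    eq = refl
applyUpTo≡range f m (suc k) eq = cong₂ _∷_ (trans (eq 0) (ℕ.+-identityʳ m))
  (applyUpTo≡range (f ∘ suc) (suc m) k (λ t → trans (eq (suc t)) (ℕ.+-suc m t)))

-- Parts and conjugate parts.

part-step : ∀ {la} → IsPartition la → ∀ i → part la (suc (suc i)) ≤ part la (suc i)
part-step []        i       = z≤n
part-step [-]       i       = z≤n
part-step (x≥y ∷ l) zero    = x≥y
part-step (x≥y ∷ l) (suc i) = part-step l i

part-bound : ∀ la i → 1 ≤ part la i → i ≤ length la
part-bound (x ∷ xs) (suc zero)    _  = s≤s z≤n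
part-bound (x ∷ xs) (suc (suc i)) le = s≤s (part-bound xs (suc i) le)

part-antitone : ∀ {la} → IsPartition la → ∀ {i k} → 1 ≤ i → i ≤ k → part la k ≤ part la i
part-antitone ip {suc i} {suc k} (s≤s _) le with ℕ.m≤n⇒m<n∨m≡n le
... | inj₂ refl = ℕ.≤-refl
part-antitone ip {suc i} {suc (suc k)} 1≤i le | inj₁ (s≤s lt) = ℕ.≤-trans (part-step ip k) (part-antitone ip 1≤i lt)
part-antitone ip {suc i} {suc zero}    1≤i le | inj₁ (s≤s ())

≤part⇒≤conj : ∀ la → IsPartition la → ∀ i j → 1 ≤ j → j ≤ part la i → i ≤ conjPart la j
≤part⇒≤conj la       ip zero    j 1≤j le = z≤n
≤part⇒≤conj []       ip (suc i) j 1≤j le = contradiction (ℕ.≤-trans 1≤j le) λ ()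
≤part⇒≤conj (x ∷ xs) ip (suc i) j 1≤j le
  rewrite filter-accept (j ≤?_) {xs = xs} (ℕ.≤-trans le (part-antitone ip {1} {suc i} (s≤s z≤n) (s≤s z≤n))) = s≤s (below i le)
  where
  below : ∀ i → j ≤ part (x ∷ xs) (suc i) → i ≤ conjPart xs j
  below zero    _  = z≤n
  below (suc i) le = ≤part⇒≤conj xs (Linked.tail ip) (suc i) j 1≤j le

-- The parts decrease weakly, so those counted by `conjPart` form a prefix: if the first part is
-- below `j`, none is counted.
≤conj⇒≤part : ∀ la → IsPartition la → ∀ i j → 1 ≤ i → i ≤ conjPart la j → j ≤ part la i
≤conj⇒≤part []       ip (suc i) j 1≤i ()
≤conj⇒≤part (x ∷ xs) ip (suc i) j 1≤i le with j ℕ.≤? x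
≤conj⇒≤part (x ∷ xs) ip (suc zero)    j 1≤i le | yes j≤x = j≤x
≤conj⇒≤part (x ∷ xs) ip (suc (suc i)) j 1≤i le | yes j≤x = ≤conj⇒≤part xs (Linked.tail ip) (suc i) j (s≤s z≤n)
  (ℕ.≤-pred (subst (suc (suc i) ≤_) (cong length (filter-accept (j ≤?_) {xs = xs} j≤x)) le))
≤conj⇒≤part (x ∷ xs) ip (suc i)       j 1≤i le | no j≰x  = contradiction
  (ℕ.≤-trans (≤conj⇒≤part xs (Linked.tail ip) 1 j ℕ.≤-refl (ℕ.≤-trans (s≤s z≤n)
    (subst (suc i ≤_) (cong length (filter-reject (j ≤?_) {xs = xs} j≰x)) le))) (part-step ip 0)) j≰x

-- A version of `val` without infinity. It is compared only at cells of `la` and at their west,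
-- north and north-west neighbours, which lie in `la` or on the zero border.
V : Filling → Cell → ℕ
V π (zero  , j)     = 0
V π (suc i , zero)  = 0
V π (suc i , suc j) = π (suc i , suc j)

V-column-zero : ∀ π i → V π (i , 0) ≡ 0
V-column-zero π zero    = refl
V-column-zero π (suc i) = refl

-P-∈ : ∀ π {Q} u → u ∈ Q → (π -P Q) u ≡ π u ∸ 1
-P-∈ π {Q} u u∈ with any? (_≟c u) Q
... | yes _ = refl
... | no ∉  = contradiction (Any.map sym u∈) ∉

-P-∉ : ∀ π {Q} u → ¬ u ∈ Q → (π -P Q) u ≡ π u
-P-∉ π {Q} u u∉ with any? (_≟c u) Q
... | yes u∈ = contradiction (Any.map sym u∈) u∉
... | no _  = refl

+P-∈ : ∀ π {Q} u → u ∈ Q → (π +P Q) u ≡ suc (π u)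
+P-∈ π {Q} u u∈ with any? (_≟c u) Q
... | yes _ = refl
... | no ∉  = contradiction (Any.map sym u∈) ∉

+P-∉ : ∀ π {Q} u → ¬ u ∈ Q → (π +P Q) u ≡ π u
+P-∉ π {Q} u u∉ with any? (_≟c u) Q
... | yes u∈ = contradiction (Any.map sym u∈) u∉
... | no _  = refl

V-P-∈ : ∀ {π Q u} → u ∈ Q → V (π -P Q) u ≡ V π u ∸ 1
V-P-∈ {u = zero  , j}     u∈ = refl
V-P-∈ {u = suc i , zero}  u∈ = refl
V-P-∈ {π} {u = suc i , suc j} u∈ = -P-∈ π _ u∈

V-P-∉ : ∀ {π Q u} → ¬ u ∈ Q → V (π -P Q) u ≡ V π u
V-P-∉ {u = zero  , j}     u∉ = refl
V-P-∉ {u = suc i , zero}  u∉ = refl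
V-P-∉ {π} {u = suc i , suc j} u∉ = -P-∉ π _ u∉

V-P-≤ : ∀ {π} Q u → V (π -P Q) u ≤ V π u
V-P-≤ {π} Q u with u ∈? Q
... | yes u∈ = ℕ.≤-trans (ℕ.≤-reflexive (V-P-∈ u∈)) (ℕ.m∸n≤m (V π u) 1)
... | no u∉  = ℕ.≤-reflexive (V-P-∉ u∉)

last-∷ : ∀ {A : Set} {x y : A} xs → last xs ≡ just y → last (x ∷ xs) ≡ just y
last-∷ (_ ∷ _) eq = eq

-- The content order and minimal elements of finite lists.

⊴-refl : ∀ {u} → u ⊴ u
⊴-refl = inj₂ (refl , ℕ.≤-refl)

⊴-total : ∀ u v → u ⊴ v ⊎ v ⊴ u
⊴-total u v with ℤ.<-cmp (content u) (content v) | ℕ.≤-total (proj₁ u) (proj₁ v)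
... | tri< lt _ _ | _       = inj₂ (inj₁ lt)
... | tri> _ _ gt | _       = inj₁ (inj₁ gt)
... | tri≈ _ eq _ | inj₁ le = inj₂ (inj₂ (sym eq , le))
... | tri≈ _ eq _ | inj₂ ge = inj₁ (inj₂ (eq , ge))

⊴-trans : ∀ {u v x} → u ⊴ v → v ⊴ x → u ⊴ x
⊴-trans             (inj₁ lt)        (inj₁ lt′)         = inj₁ (ℤ.<-trans lt′ lt)
⊴-trans {u}         (inj₁ lt)        (inj₂ (eq , _))    = inj₁ (subst (ℤ._< content u) eq lt)
⊴-trans {x = x}     (inj₂ (eq , _))  (inj₁ lt)          = inj₁ (subst (content x ℤ.<_) (sym eq) lt)
⊴-trans             (inj₂ (eq , ge)) (inj₂ (eq′ , ge′)) = inj₂ (trans eq eq′ , ℕ.≤-trans ge′ ge)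

⊴-minimum : ∀ {P : Cell → Set} → Decidable P → ∀ xs →
  (∀ {u} → u ∈ xs → ¬ P u) ⊎ (∃ λ v → P v × (∀ {u} → u ∈ xs → P u → v ⊴ u))
⊴-minimum P? [] = inj₁ λ ()
⊴-minimum P? (x ∷ xs) with P? x | ⊴-minimum P? xs
... | no ¬Px | inj₁ none           = inj₁ λ { (here refl) → ¬Px ; (there u∈) → none u∈ }
... | no ¬Px | inj₂ (v , Pv , min) = inj₂ (v , Pv , λ { (here refl) Px → contradiction Px ¬Px ; (there u∈) → min u∈ })
... | yes Px | inj₁ none           = inj₂ (x , Px , λ { (here refl) _ → ⊴-refl {x} ; (there u∈) Pu → contradiction Pu (none u∈) })
... | yes Px | inj₂ (v , Pv , min) with ⊴-total x v
... | inj₁ x⊴v = inj₂ (x , Px , λ { (here refl) _ → ⊴-refl {x} ; {u} (there u∈) Pu → ⊴-trans {x} {v} {u} x⊴v (min u∈ Pu) })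
... | inj₂ v⊴x = inj₂ (v , Pv , λ { (here refl) _ → v⊴x ; (there u∈) Pu → min u∈ Pu })

sum-map-≤ : ∀ {A : Set} {f g : A → ℕ} xs → (∀ x → f x ≤ g x) → sum (map f xs) ≤ sum (map g xs)
sum-map-≤ []       le = z≤n
sum-map-≤ (x ∷ xs) le = ℕ.+-mono-≤ (le x) (sum-map-≤ xs le)

sum-map-< : ∀ {A : Set} {f g : A → ℕ} {x} {xs} → (∀ x → f x ≤ g x) → x ∈ xs → f x < g x → sum (map f xs) < sum (map g xs)
sum-map-< {xs = _ ∷ xs} le (here refl) lt = ℕ.+-mono-<-≤ lt (sum-map-≤ xs le)
sum-map-< {xs = y ∷ _}  le (there x∈)  lt = ℕ.+-mono-≤-< (le y) (sum-map-< le x∈ lt)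

-- A path of length k from (i , j) to (a , b) has the length of a path from (c , l) to (a , b)
-- exactly when (i , j) and (c , l) have the same content.
length⇒diagonal : ∀ {a b c l} i j k → a ≤ c → l ≤ b → b + i ≡ k + (a + j) → k ≡ (c ∸ a) + (b ∸ l) → j + c ≡ l + i
length⇒diagonal {a} {l = l} i j k a≤c l≤b eq len with ℕ.m≤n⇒∃[o]m+o≡n a≤c | ℕ.m≤n⇒∃[o]m+o≡n l≤b
... | x , refl | y , refl rewrite ℕ.m+n∸m≡n a x | ℕ.m+n∸m≡n l y | len = ℕ.+-cancelˡ-≡ y _ _ (begin
  y + (j + (a + x))  ≡⟨ solve 4 (λ a j x y → y :+ (j :+ (a :+ x)) := (x :+ y) :+ (a :+ j)) refl a j x y ⟩
  (x + y) + (a + j)  ≡⟨ eq ⟨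
  (l + y) + i        ≡⟨ solve 3 (λ i l y → (l :+ y) :+ i := y :+ (l :+ i)) refl i l y ⟩
  y + (l + i)        ∎)
  where
  open ≡-Reasoning
  open +-*-Solver

diagonal⇒length : ∀ {a b c l} i j k → a ≤ c → l ≤ b → b + i ≡ k + (a + j) → j + c ≡ l + i → k ≡ (c ∸ a) + (b ∸ l)
diagonal⇒length {a} {l = l} i j k a≤c l≤b eq diag with ℕ.m≤n⇒∃[o]m+o≡n a≤c | ℕ.m≤n⇒∃[o]m+o≡n l≤b
... | x , refl | y , refl rewrite ℕ.m+n∸m≡n a x | ℕ.m+n∸m≡n l y = ℕ.+-cancelʳ-≡ (a + j) _ _ (begin
  k + (a + j)        ≡⟨ eq ⟨
  (l + y) + i        ≡⟨ solve 3 (λ i l y → (l :+ y) :+ i := y :+ (l :+ i)) refl i l y ⟩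
  y + (l + i)        ≡⟨ cong (λ t → y + t) diag ⟨
  y + (j + (a + x))  ≡⟨ solve 4 (λ a j x y → y :+ (j :+ (a :+ x)) := (x :+ y) :+ (a :+ j)) refl a j x y ⟩
  (x + y) + (a + j)  ∎)
  where
  open ≡-Reasoning
  open +-*-Solver

-- The rim as a word of east and north steps.

module Shape (la : Partition) (ip : IsPartition la) where

  part-anti : ∀ {i k} → 1 ≤ i → i ≤ k → part la k ≤ part la i
  part-anti = part-antitone ip

  -- EastStep d (NorthStep d): the rim, read from south-west to north-east, leaves its cell of content d
  -- eastwards (northwards).  The steps entering the rim (j = 0) and leaving it (i = 1) are included.
  EastStep : ℤ → Set
  EastStep d = ∃₂ λ i j → 1 ≤ i × part la (suc i) ≤ j × j < part la i × j ⊖ i ≡ d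

  NorthStep : ℤ → Set
  NorthStep d = ∃ λ i → 1 ≤ i × 1 ≤ part la i × part la i ⊖ i ≡ d

  -- If `i < k`, the north step has strictly smaller content; if `k ≤ i`, the east step has.
  east-north-exclusive : ∀ {d} → EastStep d → NorthStep d → ⊥
  east-north-exclusive (i , j , 1≤i , lo , hi , eq) (k , 1≤k , 1≤p , eq′) with i ℕ.<? k
  ... | yes i<k = ℕ.<⇒≢ (ℕ.+-mono-≤-< (ℕ.≤-trans (part-anti (s≤s z≤n) i<k) lo) i<k)
          (⊖-≡⁻ (part la k) k j i (trans eq′ (sym eq)))
  ... | no i≮k = ℕ.<⇒≢ (ℕ.+-mono-<-≤ (ℕ.<-≤-trans hi (part-anti 1≤k (ℕ.≮⇒≥ i≮k))) (ℕ.≮⇒≥ i≮k))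
          (⊖-≡⁻ j i (part la k) k (trans eq (sym eq′)))

  -- The rim cell `(k , l)` is the south-east end of the diagonal of `u`. Row `k` extends past
  -- column `l`, so row `i`, weakly above it, extends past column `j ≤ l`.
  east⇒e∈ : ∀ {u} → u ∈λ la → EastStep (content u) → e u ∈λ la
  east⇒e∈ {i , j} (1≤i , 1≤j , j≤) (k , l , 1≤k , lo , hi , eq) with k ℕ.<? i
  ... | yes k<i = contradiction (⊖-≡⁻ l k j i eq)
          (ℕ.<⇒≢ (ℕ.+-mono-≤-< z (k<i)) ∘ sym)
    where z = ℕ.≤-trans j≤ (ℕ.≤-trans (part-anti (s≤s z≤n) k<i) lo)
  ... | no k≮i = 1≤i , s≤s z≤n , ℕ.≤-trans (s≤s j≤l) (ℕ.≤-trans hi (part-anti 1≤i (ℕ.≮⇒≥ k≮i)))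
    where j≤l = ℕ.+-cancelʳ-≤ i j l (ℕ.≤-trans (ℕ.+-monoʳ-≤ j (ℕ.≮⇒≥ k≮i)) (ℕ.≤-reflexive (sym (⊖-≡⁻ l k j i eq))))

  north⇒s∈ : ∀ {u} → u ∈λ la → NorthStep (ℤ.pred (content u)) → s u ∈λ la
  north⇒s∈ {i , j} (1≤i , 1≤j , j≤) (k , 1≤k , 1≤p , eq) with i ℕ.<? k
  ... | yes i<k = s≤s z≤n , 1≤j , ℕ.≤-trans j≤p (part-anti (s≤s z≤n) i<k)
    where
    eq′ = ⊖-≡⁻ (part la k) k j (suc i) (trans eq (sym (content-s (i , j))))
    j≤p = ℕ.+-cancelʳ-≤ k j (part la k) (ℕ.≤-trans (ℕ.≤-reflexive (sym eq′)) (ℕ.+-monoʳ-≤ (part la k) i<k))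
  ... | no i≮k = contradiction (⊖-≡⁻ (part la k) k j (suc i) (trans eq (sym (content-s (i , j)))))
          (ℕ.<⇒≢ (ℕ.+-mono-≤-< (ℕ.≤-trans j≤ (part-anti 1≤k (ℕ.≮⇒≥ i≮k))) (s≤s (ℕ.≮⇒≥ i≮k))) ∘ sym)

  -- Corner contents, row by row from the bottom.

  row : ℕ → List Cell
  row i = map (λ j → (i , j)) (map suc (upTo (part la i)))

  row≡applyUpTo : ∀ i → row i ≡ applyUpTo (λ t → (i , suc t)) (part la i)
  row≡applyUpTo i = trans (cong (map _) (map-upTo suc (part la i))) (map-applyUpTo suc _ (part la i))

  module _ {P : Cell → Set} (P? : Decidable P) where

    rowCorners : ℕ → List ℤ
    rowCorners m = reverse (map content (filter P? (row m)))

    cornersFrom : ℕ → ℕ → List ℤ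
    cornersFrom m k = reverse (map content (filter P? (concatMap row (range m k))))

    -- Because of `reverse`, the topmost row contributes the end of the list, so the lists grow by
    -- appending as rows are added on top.
    cornersFrom-suc : ∀ m k → cornersFrom m (suc k) ≡ cornersFrom (suc m) k ++ rowCorners m
    cornersFrom-suc m k = begin
      reverse (map content (filter P? (row m ++ rest)))
        ≡⟨ cong (reverse ∘ map content) (filter-++ P? (row m) rest) ⟩
      reverse (map content (filter P? (row m) ++ filter P? rest))
        ≡⟨ cong reverse (map-++ content (filter P? (row m)) (filter P? rest)) ⟩
      reverse (map content (filter P? (row m)) ++ map content (filter P? rest))
        ≡⟨ reverse-++ (map content (filter P? (row m))) (map content (filter P? rest)) ⟩
      cornersFrom (suc m) k ++ rowCorners m ∎
      where
      open ≡-Reasoning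
      rest = concatMap row (range (suc m) k)

    rowCorners-none : ∀ m → (∀ t → t < part la m → ¬ P (m , suc t)) → rowCorners m ≡ []
    rowCorners-none m none = cong (reverse ∘ map content)
      (trans (cong (filter P?) (row≡applyUpTo m)) (filter-applyUpTo-none P? _ (part la m) none))

    rowCorners-unique : ∀ m j → 1 ≤ j → j ≤ part la m → P (m , j) → (∀ t → P (m , t) → t ≡ j) →
      rowCorners m ≡ [ j ⊖ m ]
    rowCorners-unique m (suc t) _ lt Pt uniq = cong (reverse ∘ map content)
      (trans (cong (filter P?) (row≡applyUpTo m))
        (filter-applyUpTo-unique P? _ (part la m) t lt Pt (λ r Pr → ℕ.suc-injective (uniq (suc r) Pr))))

    cornersFrom-empty : ∀ m k → 1 ≤ m → part la m ≡ 0 → cornersFrom m k ≡ []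
    cornersFrom-empty m zero    1≤m eq = refl
    cornersFrom-empty m (suc k) 1≤m eq = trans (cornersFrom-suc m k) (cong₂ _++_
      (cornersFrom-empty (suc m) k (s≤s z≤n) (ℕ.n≤0⇒n≡0 (ℕ.≤-trans (part-anti 1≤m (ℕ.n≤1+n m)) (ℕ.≤-reflexive eq))))
      (rowCorners-none m (λ t lt → contradiction (ℕ.≤-trans lt (ℕ.≤-reflexive eq)) λ ())))

    cornersFrom-skip : ∀ m k → (∀ t → t < part la m → ¬ P (m , suc t)) →
      cornersFrom m (suc k) ≡ cornersFrom (suc m) k
    cornersFrom-skip m k none = trans (cornersFrom-suc m k)
      (trans (cong (cornersFrom (suc m) k ++_) (rowCorners-none m none)) (++-identityʳ _))

    cornersFrom-snoc : ∀ m k j → 1 ≤ j → j ≤ part la m → P (m , j) → (∀ t → P (m , t) → t ≡ j) →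
      cornersFrom m (suc k) ≡ cornersFrom (suc m) k ++ [ j ⊖ m ]
    cornersFrom-snoc m k j 1≤j j≤ Pj uniq = trans (cornersFrom-suc m k)
      (cong (cornersFrom (suc m) k ++_) (rowCorners-unique m j 1≤j j≤ Pj uniq))

    corners≡cornersFrom : reverse (map content (filter P? (cells la))) ≡ cornersFrom 1 (length la)
    corners≡cornersFrom = cong (λ is → reverse (map content (filter P? (concatMap row is))))
      (trans (map-upTo suc (length la)) (applyUpTo≡range suc 1 (length la) (λ _ → refl)))

  outer-at : ∀ {m} → 1 ≤ m → part la (suc m) < part la m → IsOuter la (m , part la m)
  outer-at 1≤m lt = (1≤m , ℕ.≤-<-trans z≤n lt , ℕ.≤-refl) ,
    (λ (_ , _ , le) → ℕ.<-irrefl refl le) , (λ (_ , _ , le) → ℕ.<⇒≱ lt le)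

  outer⇒col : ∀ {m t} → IsOuter la (m , t) → t ≡ part la m
  outer⇒col {m} {t} ((1≤m , _ , t≤) , ¬e , _) with ℕ.m≤n⇒m<n∨m≡n t≤
  ... | inj₁ lt = contradiction (1≤m , s≤s z≤n , lt) ¬e
  ... | inj₂ eq = eq

  outer⇒drop : ∀ {m t} → IsOuter la (m , t) → part la (suc m) < part la m
  outer⇒drop ((1≤m , 1≤t , t≤) , ¬e , ¬s) =
    ℕ.≰⇒> (λ le → ¬s (s≤s z≤n , 1≤t , ℕ.≤-trans t≤ le))

  inner-at : ∀ {m} → 1 ≤ m → 1 ≤ part la (suc m) → part la (suc m) < part la m → IsInner la (m , part la (suc m))
  inner-at 1≤m 1≤p lt = (1≤m , s≤s z≤n , lt) , (s≤s z≤n , 1≤p , ℕ.≤-refl) , (λ (_ , _ , le) → ℕ.<-irrefl refl le)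

  inner⇒col : ∀ {m t} → IsInner la (m , t) → t ≡ part la (suc m)
  inner⇒col {m} {t} (_ , (_ , _ , t≤) , ¬es) with ℕ.m≤n⇒m<n∨m≡n t≤
  ... | inj₁ lt = contradiction (s≤s z≤n , s≤s z≤n , lt) ¬es
  ... | inj₂ eq = eq

  -- Besides the interlacing, every content between consecutive corners carries the direction of its
  -- rim step. The index `top` is the content where the rim of the rows treated so far ends, so that
  -- a further row can be attached there.
  data Interlaced (top : ℤ) : List ℤ → List ℤ → Set where
    one  : ∀ {o} → o ℤ.≤ top → (∀ d → o ℤ.≤ d → d ℤ.≤ top → NorthStep d) → Interlaced top (o ∷ []) []
    cons : ∀ {o i o′ os is} → o ℤ.< i → (∀ d → o ℤ.≤ d → d ℤ.< i → NorthStep d) →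
           i ℤ.< o′ → (∀ d → i ℤ.≤ d → d ℤ.< o′ → EastStep d) →
           Interlaced top (o′ ∷ os) is → Interlaced top (o ∷ o′ ∷ os) (i ∷ is)

  north-extend : ∀ {o top} → NorthStep (ℤ.suc top) → (∀ d → o ℤ.≤ d → d ℤ.≤ top → NorthStep d) →
    ∀ d → o ℤ.≤ d → d ℤ.≤ ℤ.suc top → NorthStep d
  north-extend {o} {top} new old d lo hi with d ℤ.≤? top
  ... | yes le = old d lo le
  ... | no ¬le = subst NorthStep (ℤ.≤-antisym (ℤ.i<j⇒suc[i]≤j (ℤ.≰⇒> ¬le)) hi) new

  interlaced-extend : ∀ {top os is} → NorthStep (ℤ.suc top) → Interlaced top os is → Interlaced (ℤ.suc top) os is
  interlaced-extend new (one le f)              = one (ℤ.≤-trans le (ℤ.i≤suc[i] _)) (north-extend new f)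
  interlaced-extend new (cons o<i f i<o′ g alt) = cons o<i f i<o′ g (interlaced-extend new alt)

  -- The last north run, closed at `top`, becomes half-open at the new inner corner, which has
  -- content `ℤ.suc top`.
  interlaced-snoc : ∀ {top os is i o} → i ≡ ℤ.suc top → i ℤ.< o → (∀ d → i ℤ.≤ d → d ℤ.< o → EastStep d) → NorthStep o →
    Interlaced top os is → Interlaced o (os ++ [ o ]) (is ++ [ i ])
  interlaced-snoc {top} refl lt ES NSo (one le f) =
    cons (ℤ.≤-<-trans le (<suc top)) (λ d lo hi → f d lo (subst (d ℤ.≤_) (ℤ.pred-suc top) (ℤ.i<j⇒i≤pred[j] hi))) lt ES
      (one ℤ.≤-refl (λ d lo hi → subst NorthStep (ℤ.≤-antisym lo hi) NSo))
  interlaced-snoc eq lt ES NSo (cons o<i f i<o′ g alt) = cons o<i f i<o′ g (interlaced-snoc eq lt ES NSo alt)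

  -- The lower bound on d is needed because EastStep starts at minus the number of rows.
  EastBelow : List ℤ → Set
  EastBelow os = ∃ λ o → head os ≡ just o ×
    (∀ d u → u ∈λ la → ℤ.pred (content u) ℤ.≤ d → d ℤ.< o → EastStep d)

  eastBelow-++ : ∀ {os} ps → EastBelow os → EastBelow (os ++ ps)
  eastBelow-++ {x ∷ os} ps b = b

  outersFrom innersFrom : ℕ → ℕ → List ℤ
  outersFrom = cornersFrom (isOuter? la)
  innersFrom = cornersFrom (isInner? la)

  CornersInterlaced : ℕ → ℕ → Set
  CornersInterlaced m k = Interlaced (part la m ⊖ m) (outersFrom m k) (innersFrom m k) × EastBelow (outersFrom m k)

  -- A partition may end in zero parts, so the last nonempty row is recognised by an empty row below
  -- it, and the `k` rows after it contribute no corners.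
  interlaced-bottom : ∀ m k → 1 ≤ m → 1 ≤ part la m → part la (suc m) ≡ 0 → CornersInterlaced m (suc k)
  interlaced-bottom m k 1≤m 1≤p eq
    rewrite cornersFrom-snoc (isOuter? la) m k (part la m) 1≤p ℕ.≤-refl (outer-at 1≤m (ℕ.≤-trans (s≤s (ℕ.≤-reflexive eq)) 1≤p)) (λ _ → outer⇒col)
          | cornersFrom-skip (isInner? la) m k (λ t _ (_ , (_ , _ , le) , _) → contradiction (subst (suc t ≤_) eq le) λ ())
          | cornersFrom-empty (isOuter? la) (suc m) k (s≤s z≤n) eq
          | cornersFrom-empty (isInner? la) (suc m) k (s≤s z≤n) eq =
    one ℤ.≤-refl (λ d lo hi → m , 1≤m , 1≤p , ℤ.≤-antisym lo hi) , part la m ⊖ m , refl , below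
    where
    below : ∀ d u → u ∈λ la → ℤ.pred (content u) ℤ.≤ d → d ℤ.< part la m ⊖ m → EastStep d
    below d (i , j) (1≤i , 1≤j , j≤) lo hi with ℕ.<-≤-connex m i
    ... | inj₁ m<i = contradiction (ℕ.≤-trans 1≤j (ℕ.≤-trans j≤ (ℕ.≤-trans (part-anti (s≤s z≤n) m<i) (ℕ.≤-reflexive eq)))) λ ()
    -- The search starts in column 0 of row `m`: `w u` has column at least 0 and row at most `m`,
    -- hence content at least `0 ⊖ m`.
    ... | inj₂ i≤m with ⊖-lower 0 m d (ℤ.≤-trans (⊖-≤⁺ 0 m (j ∸ 1) i (ℕ.≤-trans i≤m (ℕ.m≤n+m m (j ∸ 1))))
                         (ℤ.≤-trans (ℤ.≤-reflexive (content-w (i , j) 1≤j)) lo))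
    ... | l , _ , refl = m , l , 1≤m , ℕ.≤-trans (ℕ.≤-reflexive eq) z≤n ,
                         ℕ.+-cancelʳ-< m l (part la m) (⊖-<⁻ l m (part la m) m hi) , refl

  interlaced-level : ∀ m k → 1 ≤ m → 1 ≤ part la m → part la (suc m) ≡ part la m →
    CornersInterlaced (suc m) k → CornersInterlaced m (suc k)
  interlaced-level m k 1≤m 1≤p same (alt , below)
    rewrite cornersFrom-skip (isOuter? la) m k (λ t _ o → ℕ.<⇒≢ (outer⇒drop o) same)
          | cornersFrom-skip (isInner? la) m k
              (λ t _ c → ℕ.<⇒≢ (ℕ.≤-<-trans (ℕ.≤-reflexive (sym (inner⇒col c))) (proj₂ (proj₂ (proj₁ c)))) same) =
    subst (λ top → Interlaced top (outersFrom (suc m) k) (innersFrom (suc m) k)) (sym top-eq)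
      (interlaced-extend (m , 1≤m , 1≤p , top-eq) alt) , below
    where
    top-eq : part la m ⊖ m ≡ ℤ.suc (part la (suc m) ⊖ suc m)
    top-eq = trans (cong (_⊖ m) (sym same)) (content-n (suc m , part la (suc m)) (s≤s z≤n))

  interlaced-drop : ∀ m k → 1 ≤ m → 1 ≤ part la (suc m) → part la (suc m) < part la m →
    CornersInterlaced (suc m) k → CornersInterlaced m (suc k)
  interlaced-drop m k 1≤m 1≤p lt (alt , below)
    rewrite cornersFrom-snoc (isOuter? la) m k (part la m) (ℕ.≤-<-trans z≤n lt) ℕ.≤-refl (outer-at 1≤m lt) (λ _ → outer⇒col)
          | cornersFrom-snoc (isInner? la) m k (part la (suc m)) 1≤p (ℕ.<⇒≤ lt) (inner-at 1≤m 1≤p lt) (λ _ → inner⇒col) =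
    interlaced-snoc (content-n (suc m , part la (suc m)) (s≤s z≤n))
      (⊖-<⁺ (part la (suc m)) m (part la m) m (ℕ.+-monoˡ-< m lt)) east
      (m , 1≤m , ℕ.≤-<-trans z≤n lt , refl) alt ,
    eastBelow-++ _ below
    where
    east : ∀ d → part la (suc m) ⊖ m ℤ.≤ d → d ℤ.< part la m ⊖ m → EastStep d
    east d lo hi with ⊖-lower (part la (suc m)) m d lo
    ... | l , p≤l , refl = m , l , 1≤m , p≤l , ℕ.+-cancelʳ-< m l (part la m) (⊖-<⁻ l m (part la m) m hi) , refl

  cornersFrom-interlaced : ∀ m k → 1 ≤ m → m + k ≡ suc (length la) → 1 ≤ part la m → CornersInterlaced m k
  cornersFrom-interlaced m zero 1≤m len 1≤p =
    contradiction (part-bound la m 1≤p) (ℕ.<⇒≱ (ℕ.≤-reflexive (trans (sym len) (ℕ.+-identityʳ m))))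
  cornersFrom-interlaced m (suc k) 1≤m len 1≤p with ℕ.m≤n⇒m<n∨m≡n (z≤n {part la (suc m)}) | ℕ.m≤n⇒m<n∨m≡n (part-anti 1≤m (ℕ.n≤1+n m))
  ... | inj₂ eq   | _       = interlaced-bottom m k 1≤m 1≤p (sym eq)
  ... | inj₁ 1≤p′ | inj₂ eq = interlaced-level m k 1≤m 1≤p eq
          (cornersFrom-interlaced (suc m) k (s≤s z≤n) (trans (sym (ℕ.+-suc m k)) len) 1≤p′)
  ... | inj₁ 1≤p′ | inj₁ lt = interlaced-drop m k 1≤m 1≤p′ lt
          (cornersFrom-interlaced (suc m) k (s≤s z≤n) (trans (sym (ℕ.+-suc m k)) len) 1≤p′)

  interlaced-east : ∀ {top os is a b} → Interlaced top os is → (a , b) ∈ zip is (drop 1 os) →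
    ∀ d → a ℤ.≤ d → d ℤ.< b → EastStep d
  interlaced-east (cons _ _ _ g alt) (here refl) = g
  interlaced-east (cons _ _ _ g alt) (there p)   = interlaced-east alt p

  interlaced-north : ∀ {top os is a b} → Interlaced top os is → (a , b) ∈ zip os is →
    ∀ d → a ℤ.≤ d → d ℤ.< b → NorthStep d
  interlaced-north (cons _ f _ _ alt) (here refl) = f
  interlaced-north (cons _ f _ _ alt) (there p)   = interlaced-north alt p

  interlaced-last : ∀ {top os is o} → Interlaced top os is → last os ≡ just o →
    ∀ d → o ℤ.≤ d → d ℤ.≤ top → NorthStep d
  interlaced-last (one _ f)            refl = f
  interlaced-last (cons _ _ _ _ alt)   eq   = interlaced-last alt eq

  -- The cases match O, I, the part of A beyond the first inner corner, and the two halves of B; the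
  -- rest of A lies below the first outer corner.
  Position : List ℤ → List ℤ → ℤ → Set
  Position os is d = d ∈ os ⊎ d ∈ is
    ⊎ (∃₂ λ a b → (a , b) ∈ zip is (drop 1 os) × a ℤ.< d × d ℤ.< b)
    ⊎ (∃₂ λ a b → (a , b) ∈ zip os is × a ℤ.< d × d ℤ.< b)
    ⊎ (∃ λ o → last os ≡ just o × o ℤ.< d)

  position-there : ∀ {o i o′ os is d} → Position (o′ ∷ os) is d → Position (o ∷ o′ ∷ os) (i ∷ is) d
  position-there (inj₁ p)                                         = inj₁ (there p)
  position-there (inj₂ (inj₁ p))                                  = inj₂ (inj₁ (there p))
  position-there (inj₂ (inj₂ (inj₁ (a , b , p , q))))             = inj₂ (inj₂ (inj₁ (a , b , there p , q)))
  position-there (inj₂ (inj₂ (inj₂ (inj₁ (a , b , p , q)))))      = inj₂ (inj₂ (inj₂ (inj₁ (a , b , there p , q))))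
  position-there (inj₂ (inj₂ (inj₂ (inj₂ p))))                    = inj₂ (inj₂ (inj₂ (inj₂ p)))

  interlaced-position-∷ : ∀ {top o os is} → Interlaced top (o ∷ os) is → ∀ d → o ℤ.≤ d → Position (o ∷ os) is d
  interlaced-position-∷ {o = o} (one _ _) d o≤d with o ℤ.≟ d
  ... | yes refl = inj₁ (here refl)
  ... | no o≢d   = inj₂ (inj₂ (inj₂ (inj₂ (o , refl , ℤ.≤∧≢⇒< o≤d o≢d))))
  interlaced-position-∷ {o = o} (cons {i = i} {o′ = o′} _ _ _ _ alt) d o≤d with o ℤ.≟ d | ℤ.<-cmp d i | d ℤ.<? o′
  ... | yes refl | _            | _      = inj₁ (here refl)
  ... | no o≢d   | tri< d<i _ _ | _      = inj₂ (inj₂ (inj₂ (inj₁ (o , i , here refl , ℤ.≤∧≢⇒< o≤d o≢d , d<i))))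
  ... | no _     | tri≈ _ eq _  | _      = inj₂ (inj₁ (here eq))
  ... | no _     | tri> _ _ i<d | yes lt = inj₂ (inj₂ (inj₁ (i , o′ , here refl , i<d , lt)))
  ... | no _     | tri> _ _ i<d | no ≮   = position-there (interlaced-position-∷ alt d (ℤ.≮⇒≥ ≮))

  interlaced-position : ∀ {top o os is} → Interlaced top os is → head os ≡ just o → ∀ d → o ℤ.≤ d → Position os is d
  interlaced-position {os = _ ∷ _} alt refl = interlaced-position-∷ alt

  corners-interlaced : ∀ {u} → u ∈λ la →
    Interlaced (part la 1 ⊖ 1) (outerContents la) (innerContents la) × EastBelow (outerContents la)
  corners-interlaced (1≤i , 1≤j , j≤)
    rewrite corners≡cornersFrom (isOuter? la) | corners≡cornersFrom (isInner? la) =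
    cornersFrom-interlaced 1 (length la) ℕ.≤-refl refl (ℕ.≤-trans 1≤j (ℕ.≤-trans j≤ (part-anti ℕ.≤-refl 1≤i)))

  content≤top : ∀ {u} → u ∈λ la → content u ℤ.≤ part la 1 ⊖ 1
  content≤top {i , j} (1≤i , 1≤j , j≤) =
    ⊖-≤⁺ j i (part la 1) 1 (ℕ.+-mono-≤ (ℕ.≤-trans j≤ (part-anti ℕ.≤-refl 1≤i)) 1≤i)

  corner⁻ : ∀ {P : Cell → Set} (P? : Decidable P) {d} → d ∈ reverse (map content (filter P? (cells la))) →
    ∃ λ c → P c × d ≡ content c
  corner⁻ P? d∈ with ∈-map⁻ content (reverse⁻ d∈)
  ... | c , c∈ , eq = c , proj₂ (∈-filter⁻ P? {xs = cells la} c∈) , eq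

  -- A step is indexed by the content where it starts, so the step into the rim cell of content `c`
  -- has index `c - 1`.
  EastIn NorthIn EastOut NorthOut : Cell → Set
  EastIn   u = EastStep (ℤ.pred (content u))
  NorthIn  u = NorthStep (ℤ.pred (content u))
  EastOut  u = EastStep (content u)
  NorthOut u = NorthStep (content u)

  outer-steps : ∀ {c} → IsOuter la c → EastIn c × NorthOut c
  outer-steps {i , suc j} o@((1≤i , 1≤j , j≤) , _) with outer⇒col o | outer⇒drop o
  ... | eq | lt =
    (i , j , 1≤i , ℕ.≤-pred (subst (part la (suc i) <_) (sym eq) lt) , j≤ , content-w (i , suc j) 1≤j) ,
    (i , 1≤i , subst (1 ≤_) eq 1≤j , cong (_⊖ i) (sym eq))

  inner-steps : ∀ {c} → IsInner la c → NorthIn c × EastOut c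
  inner-steps {i , j} c@((1≤i , _ , j<) , (_ , 1≤j , _) , _) with inner⇒col c
  ... | eq =
    (suc i , s≤s z≤n , subst (1 ≤_) eq 1≤j , trans (cong (_⊖ suc i) (sym eq)) (content-s (i , j))) ,
    (i , j , 1≤i , ℕ.≤-reflexive (sym eq) , j< , refl)

  InO⇒steps : ∀ {u} → InO la u → EastIn u × NorthOut u
  InO⇒steps (_ , d∈) with corner⁻ (isOuter? la) d∈
  ... | c , o , eq rewrite eq = outer-steps o

  InI⇒steps : ∀ {u} → InI la u → NorthIn u × EastOut u
  InI⇒steps (_ , d∈) with corner⁻ (isInner? la) d∈
  ... | c , o , eq rewrite eq = inner-steps o

  InA⇒steps : ∀ {u} → InA la u → EastIn u × EastOut u
  InA⇒steps {u} (u∈ , inj₁ (o , hd , lt)) with proj₂ (corners-interlaced u∈)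
  ... | o′ , hd′ , below with just-injective (trans (sym hd) hd′)
  ... | refl = below (ℤ.pred (content u)) u u∈ ℤ.≤-refl (ℤ.<-trans (pred< (content u)) lt) ,
               below (content u) u u∈ (ℤ.<⇒≤ (pred< (content u))) lt
  InA⇒steps {u} (u∈ , inj₂ ((a , b) , ab∈ , a< , <b)) =
    east (ℤ.pred (content u)) (ℤ.i<j⇒i≤pred[j] a<) (ℤ.<-trans (pred< (content u)) <b) , east (content u) (ℤ.<⇒≤ a<) <b
    where east = interlaced-east (proj₁ (corners-interlaced u∈)) ab∈

  InB⇒steps : ∀ {u} → InB la u → NorthIn u × NorthOut u
  InB⇒steps {u} (u∈ , inj₁ ((a , b) , ab∈ , a< , <b)) =
    north (ℤ.pred (content u)) (ℤ.i<j⇒i≤pred[j] a<) (ℤ.<-trans (pred< (content u)) <b) , north (content u) (ℤ.<⇒≤ a<) <b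
    where north = interlaced-north (proj₁ (corners-interlaced u∈)) ab∈
  InB⇒steps {u} (u∈ , inj₂ (o , lst , o<)) =
    north (ℤ.pred (content u)) (ℤ.i<j⇒i≤pred[j] o<) (ℤ.<⇒≤ (ℤ.<-≤-trans (pred< (content u)) (content≤top u∈))) ,
    north (content u) (ℤ.<⇒≤ o<) (content≤top u∈)
    where north = interlaced-last (proj₁ (corners-interlaced u∈)) lst

  classify : ∀ {u} → u ∈λ la → InO la u ⊎ InI la u ⊎ InA la u ⊎ InB la u
  classify {u} u∈ with corners-interlaced u∈
  ... | alt , o , hd , below with content u ℤ.<? o
  ... | yes lt = inj₂ (inj₂ (inj₁ (u∈ , inj₁ (o , hd , lt))))
  ... | no ≮ with interlaced-position alt hd (content u) (ℤ.≮⇒≥ ≮)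
  ... | inj₁ p                                         = inj₁ (u∈ , p)
  ... | inj₂ (inj₁ p)                                  = inj₂ (inj₁ (u∈ , p))
  ... | inj₂ (inj₂ (inj₁ (a , b , p)))                 = inj₂ (inj₂ (inj₁ (u∈ , inj₂ ((a , b) , p))))
  ... | inj₂ (inj₂ (inj₂ (inj₁ (a , b , p))))          = inj₂ (inj₂ (inj₂ (u∈ , inj₁ ((a , b) , p))))
  ... | inj₂ (inj₂ (inj₂ (inj₂ p)))                    = inj₂ (inj₂ (inj₂ (u∈ , inj₂ p)))

  steps⇒InO : ∀ {u} → u ∈λ la → EastIn u → NorthOut u → InO la u
  steps⇒InO u∈ ein nout with classify u∈
  ... | inj₁ o               = o
  ... | inj₂ (inj₁ i)        = ⊥-elim (east-north-exclusive ein (proj₁ (InI⇒steps i)))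
  ... | inj₂ (inj₂ (inj₁ a)) = ⊥-elim (east-north-exclusive (proj₂ (InA⇒steps a)) nout)
  ... | inj₂ (inj₂ (inj₂ b)) = ⊥-elim (east-north-exclusive ein (proj₁ (InB⇒steps b)))

  steps⇒InA : ∀ {u} → u ∈λ la → EastIn u → EastOut u → InA la u
  steps⇒InA u∈ ein eout with classify u∈
  ... | inj₁ o               = ⊥-elim (east-north-exclusive eout (proj₂ (InO⇒steps o)))
  ... | inj₂ (inj₁ i)        = ⊥-elim (east-north-exclusive ein (proj₁ (InI⇒steps i)))
  ... | inj₂ (inj₂ (inj₁ a)) = a
  ... | inj₂ (inj₂ (inj₂ b)) = ⊥-elim (east-north-exclusive ein (proj₁ (InB⇒steps b)))

  InIA⇒eastOut : ∀ {u} → InI la u ⊎ InA la u → EastOut u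
  InIA⇒eastOut (inj₁ i) = proj₂ (InI⇒steps i)
  InIA⇒eastOut (inj₂ a) = proj₂ (InA⇒steps a)

  InOB⇒northOut : ∀ {u} → InO la u ⊎ InB la u → NorthOut u
  InOB⇒northOut (inj₁ o) = proj₂ (InO⇒steps o)
  InOB⇒northOut (inj₂ b) = proj₂ (InB⇒steps b)

  InBI⇒northIn : ∀ {u} → InB la u ⊎ InI la u → NorthIn u
  InBI⇒northIn (inj₁ b) = proj₁ (InB⇒steps b)
  InBI⇒northIn (inj₂ i) = proj₁ (InI⇒steps i)

  northIn⇒InBI : ∀ {u} → u ∈λ la → NorthIn u → InB la u ⊎ InI la u
  northIn⇒InBI u∈ nin with classify u∈
  ... | inj₁ o               = ⊥-elim (east-north-exclusive (proj₁ (InO⇒steps o)) nin)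
  ... | inj₂ (inj₁ i)        = inj₂ i
  ... | inj₂ (inj₂ (inj₁ a)) = ⊥-elim (east-north-exclusive (proj₁ (InA⇒steps a)) nin)
  ... | inj₂ (inj₂ (inj₂ b)) = inj₁ b

  InIA-or-InOB : ∀ {u} → u ∈λ la → (InI la u ⊎ InA la u) ⊎ (InO la u ⊎ InB la u)
  InIA-or-InOB u∈ with classify u∈
  ... | inj₁ o               = inj₂ (inj₁ o)
  ... | inj₂ (inj₁ i)        = inj₁ (inj₁ i)
  ... | inj₂ (inj₂ (inj₁ a)) = inj₁ (inj₂ a)
  ... | inj₂ (inj₂ (inj₂ b)) = inj₂ (inj₂ b)

  eastOut-or-northOut : ∀ {u} → u ∈λ la → EastOut u ⊎ NorthOut u
  eastOut-or-northOut u∈ with InIA-or-InOB u∈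
  ... | inj₁ ia = inj₁ (InIA⇒eastOut ia)
  ... | inj₂ ob = inj₂ (InOB⇒northOut ob)

  eastIn-or-northIn : ∀ {u} → u ∈λ la → EastIn u ⊎ NorthIn u
  eastIn-or-northIn u∈ with classify u∈
  ... | inj₁ o               = inj₁ (proj₁ (InO⇒steps o))
  ... | inj₂ (inj₁ i)        = inj₂ (proj₁ (InI⇒steps i))
  ... | inj₂ (inj₂ (inj₁ a)) = inj₁ (proj₁ (InA⇒steps a))
  ... | inj₂ (inj₂ (inj₂ b)) = inj₂ (proj₁ (InB⇒steps b))

  -- Values on the shape and on its zero border.

  V≡π : ∀ {π u} → u ∈λ la → V π u ≡ π u
  V≡π {u = suc i , suc j} _ = refl

  val-∈ : ∀ {π u} → u ∈λ la → val la π u ≡ just (V π u)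
  val-∈ {u = suc i , suc j} u∈ with (suc i , suc j) ∈λ? la
  ... | yes _ = refl
  ... | no ∉  = contradiction u∈ ∉

  val-cong : ∀ {π ρ} → π ≈[ la ] ρ → ∀ u → val la π u ≡ val la ρ u
  val-cong eq (zero  , j)     = refl
  val-cong eq (suc i , zero)  = refl
  val-cong eq (suc i , suc j) with (suc i , suc j) ∈λ? la
  ... | yes u∈ = cong just (eq _ u∈)
  ... | no _   = refl

  n∈ : ∀ {i j} → (suc (suc i) , j) ∈λ la → (suc i , j) ∈λ la
  n∈ (_ , 1≤j , j≤) = s≤s z≤n , 1≤j , ℕ.≤-trans j≤ (part-anti (s≤s z≤n) (ℕ.n≤1+n _))

  w∈ : ∀ {i j} → (i , suc (suc j)) ∈λ la → (i , suc j) ∈λ la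
  w∈ (1≤i , _ , j≤) = 1≤i , s≤s z≤n , ℕ.<⇒≤ j≤

  val-n : ∀ {π u} → u ∈λ la → val la π (n u) ≡ just (V π (n u))
  val-n {u = suc zero    , j} u∈ = refl
  val-n {u = suc (suc i) , j} u∈ = val-∈ (n∈ u∈)

  val-w : ∀ {π u} → u ∈λ la → val la π (w u) ≡ just (V π (w u))
  val-w {u = suc i , suc zero}    u∈ = refl
  val-w {u = suc i , suc (suc j)} u∈ = val-∈ (w∈ u∈)

  n∈-pos : ∀ {π u} → u ∈λ la → 0 < V π (n u) → n u ∈λ la
  n∈-pos {u = suc zero    , j} u∈ ()
  n∈-pos {u = suc (suc i) , j} u∈ _ = n∈ u∈

  Mono : Filling → Set
  Mono π = ∀ u → u ∈λ la → V π (w u) ≤ V π u × V π (n u) ≤ V π u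

  rpp⇒mono : ∀ {π} → IsRPP la π → Mono π
  rpp⇒mono {π} rpp u@(suc i , suc j) u∈ = west j u∈ , north i u∈
    where
    west : ∀ j → (suc i , suc j) ∈λ la → V π (suc i , j) ≤ V π (suc i , suc j)
    west zero    u∈ = z≤n
    west (suc j) u∈ = subst₂ _≤∞_ (val-∈ (w∈ u∈)) (val-∈ u∈) (proj₁ (rpp _ (w∈ u∈)))
    north : ∀ i → (suc i , suc j) ∈λ la → V π (i , suc j) ≤ V π (suc i , suc j)
    north zero    u∈ = z≤n
    north (suc i) u∈ = subst₂ _≤∞_ (val-∈ (n∈ u∈)) (val-∈ u∈) (proj₂ (rpp _ (n∈ u∈)))

  mono⇒rpp : ∀ {π} → Mono π → IsRPP la π
  mono⇒rpp {π} mono u@(suc i , suc j) u∈ = east , south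
    where
    east : val la π u ≤∞ val la π (e u)
    east with e u ∈λ? la
    ... | yes e∈ = subst₂ _≤∞_ (sym (val-∈ u∈)) refl (proj₁ (mono (e u) e∈))
    ... | no _ = subst (_≤∞ nothing) (sym (val-∈ u∈)) _
    south : val la π u ≤∞ val la π (s u)
    south with s u ∈λ? la
    ... | yes s∈ = subst₂ _≤∞_ (sym (val-∈ u∈)) refl (proj₂ (mono (s u) s∈))
    ... | no _ = subst (_≤∞ nothing) (sym (val-∈ u∈)) _

  rpp-cong : ∀ {π ρ} → π ≈[ la ] ρ → IsRPP la π → IsRPP la ρ
  rpp-cong eq rpp u u∈ =
    subst₂ _≤∞_ (val-cong eq u) (val-cong eq (e u)) (proj₁ (rpp u u∈)) ,
    subst₂ _≤∞_ (val-cong eq u) (val-cong eq (s u)) (proj₂ (rpp u u∈))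

  nw≤w : ∀ {π} → Mono π → ∀ {u} → u ∈λ la → V π (n (w u)) ≤ V π (w u)
  nw≤w {π} mono {suc i , suc zero}    u∈ = ℕ.≤-reflexive (V-column-zero π i)
  nw≤w {π} mono {suc i , suc (suc j)} u∈ = proj₂ (mono _ (w∈ u∈))

  content-n∈ : ∀ {u} → u ∈λ la → content (n u) ≡ ℤ.suc (content u)
  content-n∈ {u} (1≤i , _) = content-n u 1≤i

  eastOut⇒eastIn-e : ∀ {u} → EastOut u → EastIn (e u)
  eastOut⇒eastIn-e {u} = subst EastStep (sym (trans (cong ℤ.pred (content-e u)) (ℤ.pred-suc _)))

  eastOut⇒eastIn-n : ∀ {u} → u ∈λ la → EastOut u → EastIn (n u)
  eastOut⇒eastIn-n u∈ = subst EastStep (sym (trans (cong ℤ.pred (content-n∈ u∈)) (ℤ.pred-suc _)))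

  northOut⇒northIn-n : ∀ {u} → u ∈λ la → NorthOut u → NorthIn (n u)
  northOut⇒northIn-n u∈ = subst NorthStep (sym (trans (cong ℤ.pred (content-n∈ u∈)) (ℤ.pred-suc _)))

  -- One description for both kinds of candidates: in O the rim leaves northwards, which replaces
  -- the comparison with the north neighbour required in A.
  Candidate : Filling → Cell → Set
  Candidate π u = u ∈λ la × EastIn u × V π (w u) < V π u × (NorthOut u ⊎ V π (n u) < V π u)

  cand⇒candidate : ∀ {π u} → Cand la π u → Candidate π u
  cand⇒candidate (inj₁ (o , w<)) =
    proj₁ o , proj₁ (InO⇒steps o) , subst₂ _<∞_ (val-w (proj₁ o)) (val-∈ (proj₁ o)) w< , inj₁ (proj₂ (InO⇒steps o))
  cand⇒candidate (inj₂ (a , w< , n<)) =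
    proj₁ a , proj₁ (InA⇒steps a) , subst₂ _<∞_ (val-w (proj₁ a)) (val-∈ (proj₁ a)) w< ,
    inj₂ (subst₂ _<∞_ (val-n (proj₁ a)) (val-∈ (proj₁ a)) n<)

  candidate⇒cand : ∀ {π u} → Candidate π u → Cand la π u
  candidate⇒cand (u∈ , ein , w< , alt) with eastOut-or-northOut u∈ | alt
  ... | inj₂ nout | _         = inj₁ (steps⇒InO u∈ ein nout , subst₂ _<∞_ (sym (val-w u∈)) (sym (val-∈ u∈)) w<)
  ... | inj₁ eout | inj₁ nout = ⊥-elim (east-north-exclusive eout nout)
  ... | inj₁ eout | inj₂ n<   = inj₂ (steps⇒InA u∈ ein eout ,
    subst₂ _<∞_ (sym (val-w u∈)) (sym (val-∈ u∈)) w< , subst₂ _<∞_ (sym (val-n u∈)) (sym (val-∈ u∈)) n<)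

  NoCandidateAbove : Filling → ℤ → Set
  NoCandidateAbove π c = ∀ u → Candidate π u → content u ℤ.≤ c

  module Flat {π : Filling} {c : ℤ} (mono : Mono π) (above : NoCandidateAbove π c) where

    -- If x violated the claim without being a candidate, then its northern neighbour would violate it as well.
    flat : ∀ i j → (i , j) ∈λ la → EastIn (i , j) → c ℤ.< content (i , j) → V π (w (i , j)) ≡ V π (i , j)
    flat (suc i) j x∈ ein c< with ℕ.m≤n⇒m<n∨m≡n (proj₁ (mono _ x∈)) | ℕ.m≤n⇒m<n∨m≡n (proj₂ (mono _ x∈)) | eastOut-or-northOut x∈
    ... | inj₂ eq | _       | _         = eq
    ... | inj₁ w< | _       | inj₂ nout = ⊥-elim (ℤ.<⇒≱ c< (above _ (x∈ , ein , w< , inj₁ nout)))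
    ... | inj₁ w< | inj₁ n< | inj₁ _    = ⊥-elim (ℤ.<⇒≱ c< (above _ (x∈ , ein , w< , inj₂ n<)))
    ... | inj₁ w< | inj₂ n≡ | inj₁ eout = ⊥-elim (ℕ.<-irrefl
            (trans (flat i j n∈λ (eastOut⇒eastIn-n x∈ eout) c<n) n≡) (ℕ.≤-<-trans (nw≤w mono x∈) w<))
      where
      n∈λ = n∈-pos x∈ (subst (0 <_) (sym n≡) (ℕ.≤-<-trans z≤n w<))
      c<n = subst (c ℤ.<_) (sym (content-n∈ x∈)) (ℤ.<-trans c< (<suc _))

    flat-e : ∀ {z} → z ∈λ la → EastOut z → c ℤ.≤ content z → V π z ≡ V π (e z)
    flat-e {z} z∈ eout c≤ = flat (proj₁ z) (suc (proj₂ z)) (east⇒e∈ z∈ eout) (eastOut⇒eastIn-e {z} eout)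
      (subst (c ℤ.<_) (sym (content-e z)) (ℤ.≤-<-trans c≤ (<suc _)))

    -- The cell `n z` lies on the diagonal that the rim reaches by its east step from that of `z`,
    -- and its west neighbour is `n (w z)`.
    flat-n : ∀ {z} → z ∈λ la → EastOut z → c ℤ.≤ content z → V π (n (w z)) ≡ V π (n z)
    flat-n {suc zero    , j} z∈ eout c≤ = refl
    flat-n {suc (suc i) , j} z∈ eout c≤ = flat (suc i) j (n∈ z∈) (eastOut⇒eastIn-n z∈ eout)
      (subst (c ℤ.<_) (sym (content-n∈ z∈)) (ℤ.≤-<-trans c≤ (<suc _)))

    Invariant : Cell → Set
    Invariant u = u ∈λ la × c ℤ.≤ content u × V π (n (w u)) < V π u

    invariant-n< : ∀ {u} → Invariant u → EastOut u → V π (n u) < V π u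
    invariant-n< {u} (u∈ , c≤ , nw<) eout = subst (_< V π u) (flat-n u∈ eout c≤) nw<

    -- The north-west neighbour of `e u` is `n u`, so strictness towards the north is exactly what
    -- an east move has to hand on.
    invariant-e : ∀ {u} → Invariant u → V π (n u) < V π u → e u ∈λ la → Invariant (e u)
    invariant-e {u} (u∈ , c≤ , nw<) n< e∈ = e∈ ,
      subst (c ℤ.≤_) (sym (content-e u)) (ℤ.≤-trans c≤ (ℤ.i≤suc[i] _)) , ℕ.<-≤-trans n< (proj₁ (mono (e u) e∈))

    invariant-n : ∀ {u} → Invariant u → V π u ≡ V π (n u) → Invariant (n u)
    invariant-n {u} (u∈ , c≤ , nw<) eq = n∈λ ,
      subst (c ℤ.≤_) (sym (content-n∈ u∈)) (ℤ.≤-trans c≤ (ℤ.i≤suc[i] _)) ,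
      ℕ.≤-<-trans (nw≤w mono n∈λ) (subst (V π (n (w u)) <_) eq nw<)
      where n∈λ = n∈-pos u∈ (subst (0 <_) eq (ℕ.≤-<-trans z≤n nw<))

  -- Each move keeps the relations between values of π that justify it, in place of the class
  -- conditions by which `QPath` selects it; only the direction of the rim is retained for north
  -- moves.
  data Path (π : Filling) (ω : Cell) : Cell → List Cell → Set where
    stop  : ω ∈λ la → V π (n ω) < V π ω → ¬ e ω ∈λ la → Path π ω ω (ω ∷ [])
    north : ∀ {u P} → u ∈λ la → NorthOut u → V π (n (w u)) < V π u → V π u ≡ V π (n u) → Path π ω (n u) P → Path π ω u (u ∷ P)
    east  : ∀ {u P} → u ∈λ la → V π (n u) < V π u → e u ∈λ la → Path π ω (e u) P → Path π ω u (u ∷ P)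

  module Paths {π : Filling} {ω : Cell} where

    path-start : ∀ {u Q} → Path π ω u Q → u ∈ Q
    path-start (stop _ _ _)      = here refl
    path-start (north _ _ _ _ _) = here refl
    path-start (east _ _ _ _)    = here refl

    path-∈ : ∀ {u Q x} → Path π ω u Q → x ∈ Q → x ∈λ la
    path-∈ (stop u∈ _ _)      (here refl) = u∈
    path-∈ (north u∈ _ _ _ p) (here refl) = u∈
    path-∈ (north u∈ _ _ _ p) (there x∈)  = path-∈ p x∈
    path-∈ (east u∈ _ _ p)    (here refl) = u∈
    path-∈ (east u∈ _ _ p)    (there x∈)  = path-∈ p x∈

    path-pos : ∀ {u Q x} → Path π ω u Q → x ∈ Q → 0 < V π x
    path-pos (stop _ n< _)      (here refl) = ℕ.≤-<-trans z≤n n<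
    path-pos (north _ _ nw< _ p) (here refl) = ℕ.≤-<-trans z≤n nw<
    path-pos (north _ _ _ _ p)  (there x∈)  = path-pos p x∈
    path-pos (east _ n< _ p)    (here refl) = ℕ.≤-<-trans z≤n n<
    path-pos (east _ _ _ p)     (there x∈)  = path-pos p x∈

    path-content : ∀ {u Q x} → Path π ω u Q → x ∈ Q → content u ℤ.≤ content x
    after-north : ∀ {u Q x} → u ∈λ la → Path π ω (n u) Q → x ∈ Q → content u ℤ.< content x
    after-east : ∀ {u Q x} → Path π ω (e u) Q → x ∈ Q → content u ℤ.< content x
    path-content (stop _ _ _)       (here refl) = ℤ.≤-refl
    path-content (north _ _ _ _ _)  (here refl) = ℤ.≤-refl
    path-content (north u∈ _ _ _ p) (there x∈)  = ℤ.<⇒≤ (after-north u∈ p x∈)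
    path-content (east _ _ _ _)     (here refl) = ℤ.≤-refl
    path-content (east {u} _ _ _ p) (there x∈)  = ℤ.<⇒≤ (after-east {u} p x∈)
    after-north u∈ p x∈ = ℤ.<-≤-trans (<suc _) (subst (ℤ._≤ _) (content-n∈ u∈) (path-content p x∈))
    after-east {u} p x∈ = ℤ.<-≤-trans (<suc _) (subst (ℤ._≤ _) (content-e u) (path-content p x∈))

    path-unique : ∀ {u Q x y} → Path π ω u Q → x ∈ Q → y ∈ Q → content x ≡ content y → x ≡ y
    path-unique (stop _ _ _)       (here refl) (here refl) eq = refl
    path-unique (north _ _ _ _ _)  (here refl) (here refl) eq = refl
    path-unique (north u∈ _ _ _ p) (here refl) (there y∈)  eq = ⊥-elim (ℤ.<-irrefl eq (after-north u∈ p y∈))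
    path-unique (north u∈ _ _ _ p) (there x∈)  (here refl) eq = ⊥-elim (ℤ.<-irrefl (sym eq) (after-north u∈ p x∈))
    path-unique (north _ _ _ _ p)  (there x∈)  (there y∈)  eq = path-unique p x∈ y∈ eq
    path-unique (east _ _ _ _)     (here refl) (here refl) eq = refl
    path-unique (east {u} _ _ _ p) (here refl) (there y∈)  eq = ⊥-elim (ℤ.<-irrefl eq (after-east {u} p y∈))
    path-unique (east {u} _ _ _ p) (there x∈)  (here refl) eq = ⊥-elim (ℤ.<-irrefl (sym eq) (after-east {u} p x∈))
    path-unique (east _ _ _ p)     (there x∈)  (there y∈)  eq = path-unique p x∈ y∈ eq

    NorthMove EastMove : List Cell → Cell → Set
    NorthMove Q y = y ∈ Q × y ∈λ la × NorthOut y × V π (n (w y)) < V π y × V π y ≡ V π (n y)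
    EastMove Q z = z ∈ Q × V π (n z) < V π z

    -- The move into a cell controls its comparison with the west neighbour; the move out of it,
    -- recorded by `Exit`, controls that with the north neighbour.
    Entry : List Cell → Cell → Cell → Set
    Entry Q u x = x ≡ u ⊎ (∃ λ y → x ≡ n y × NorthMove Q y) ⊎ (∃ λ z → x ≡ e z × EastMove Q z)

    entry-there : ∀ {u u′ x Q} → Entry Q u′ x → Entry (u ∷ Q) u u′ → Entry (u ∷ Q) u x
    entry-there (inj₁ refl)                        first = first
    entry-there (inj₂ (inj₁ (y , eq , y∈ , move))) _     = inj₂ (inj₁ (y , eq , there y∈ , move))
    entry-there (inj₂ (inj₂ (z , eq , z∈ , move))) _     = inj₂ (inj₂ (z , eq , there z∈ , move))

    path-entry : ∀ {u Q x} → Path π ω u Q → x ∈ Q → Entry Q u x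
    path-entry (stop _ _ _)                  (here refl) = inj₁ refl
    path-entry (north _ _ _ _ _)             (here refl) = inj₁ refl
    path-entry (north {u} u∈ nout nw< n≡ p)  (there x∈)  =
      entry-there (path-entry p x∈) (inj₂ (inj₁ (u , refl , here refl , u∈ , nout , nw< , n≡)))
    path-entry (east _ _ _ _)                (here refl) = inj₁ refl
    path-entry (east {u} u∈ n< e∈ p)         (there x∈)  =
      entry-there (path-entry p x∈) (inj₂ (inj₂ (u , refl , here refl , n<)))

    Exit : List Cell → Cell → Set
    Exit Q x = (n x ∈ Q × NorthOut x × V π x ≡ V π (n x)) ⊎ (V π (n x) < V π x × (e x ∈ Q ⊎ ¬ e x ∈λ la))

    exit-there : ∀ {u x Q} → Exit Q x → Exit (u ∷ Q) x
    exit-there (inj₁ (n∈Q , move))        = inj₁ (there n∈Q , move)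
    exit-there (inj₂ (move , inj₁ e∈Q))   = inj₂ (move , inj₁ (there e∈Q))
    exit-there (inj₂ (move , inj₂ e∉))    = inj₂ (move , inj₂ e∉)

    path-exit : ∀ {u Q x} → Path π ω u Q → x ∈ Q → Exit Q x
    path-exit (stop _ n< e∉)         (here refl) = inj₂ (n< , inj₂ e∉)
    path-exit (north _ nout _ n≡ p)  (here refl) = inj₁ (there (path-start p) , nout , n≡)
    path-exit (north _ _ _ _ p)      (there x∈)  = exit-there (path-exit p x∈)
    path-exit (east _ n< _ p)        (here refl) = inj₂ (n< , inj₁ (there (path-start p)))
    path-exit (east _ _ _ p)         (there x∈)  = exit-there (path-exit p x∈)

    path-last : ∀ {u Q} → Path π ω u Q → last Q ≡ just ω
    path-last (stop _ _ _)                  = refl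
    path-last (north {P = P} _ _ _ _ p)     = last-∷ P (path-last p)
    path-last (east {P = P} _ _ _ p)        = last-∷ P (path-last p)

    path-end : ∀ {u Q} → Path π ω u Q → ω ∈λ la × ¬ e ω ∈λ la
    path-end (stop ω∈ _ e∉)    = ω∈ , e∉
    path-end (north _ _ _ _ p) = path-end p
    path-end (east _ _ _ p)    = path-end p

    path-row : ∀ {u Q} → Path π ω u Q → proj₁ ω ≤ proj₁ u
    path-row (stop _ _ _)          = ℕ.≤-refl
    path-row (north {u} _ _ _ _ p) = ℕ.≤-trans (path-row p) (ℕ.m∸n≤m (proj₁ u) 1)
    path-row (east _ _ _ p)        = path-row p

    path-length : ∀ {u Q} → Path π ω u Q → suc (proj₂ ω + proj₁ u) ≡ length Q + (proj₁ ω + proj₂ u)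
    path-length (stop _ _ _) = cong suc (ℕ.+-comm (proj₂ ω) (proj₁ ω))
    path-length (north {suc i , j} _ _ _ _ p) = cong suc (trans (ℕ.+-suc (proj₂ ω) i) (path-length p))
    path-length (east {i , j} {P} _ _ _ p) = trans (path-length p)
      (trans (cong (λ k → length P + k) (ℕ.+-suc (proj₁ ω) j)) (ℕ.+-suc (length P) (proj₁ ω + j)))

  open Paths

  -- Extracting Q and inserting it back.

  module Extract {π : Filling} {v : Cell} (mono : Mono π) (cand : Candidate π v) (above : NoCandidateAbove π (content v)) where
    open Flat mono above

    invariant-start : Invariant v
    invariant-start = let (v∈ , _ , w< , _) = cand in v∈ , ℤ.≤-refl , ℕ.≤-<-trans (nw≤w mono v∈) w<

    q⇒path : ∀ {u Q} → Invariant u → QPath la π u Q → ∃ λ ω → Path π ω u Q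
    q⇒path inv@(_ , _ , nw<) (q-n u∈ ob eq q) =
      let n≡ = just-injective (trans (sym (val-∈ u∈)) (trans eq (val-n u∈)))
          (ω , p) = q⇒path (invariant-n inv n≡) q
      in ω , north u∈ (InOB⇒northOut ob) nw< n≡ p
    q⇒path inv (q-e u∈ (inj₁ ia) q) =
      let eout = InIA⇒eastOut ia
          n< = invariant-n< inv eout
          e∈ = east⇒e∈ u∈ eout
          (ω , p) = q⇒path (invariant-e inv n< e∈) q
      in ω , east u∈ n< e∈ p
    q⇒path inv (q-e u∈ (inj₂ (e∈ , lt)) q) =
      let n< = subst₂ _<∞_ (val-n u∈) (val-∈ u∈) lt
          (ω , p) = q⇒path (invariant-e inv n< e∈) q
      in ω , east u∈ n< e∈ p
    q⇒path inv (q-stop {u} u∈ lt e∉) = u , stop u∈ (subst₂ _<∞_ (val-n u∈) (val-∈ u∈) lt) e∉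

    -- Every move raises the content by one while it stays below `part la 1`; `k` bounds the moves
    -- left.
    q-exists : ∀ k i j → Invariant (i , j) → part la 1 + i ≤ k + j → ∃ λ Q → QPath la π (i , j) Q
    q-exists zero i j ((1≤i , _ , j≤) , _) le =
      contradiction (ℕ.≤-trans j≤ (part-anti ℕ.≤-refl 1≤i)) (ℕ.<⇒≱ (ℕ.<-≤-trans (ℕ.m<m+n (part la 1) 1≤i) le))
    q-exists (suc k) (suc i) j inv@(u∈ , _) le with InIA-or-InOB u∈
    ... | inj₁ ia =
      let eout = InIA⇒eastOut ia
          (Q , q) = q-exists k (suc i) (suc j) (invariant-e inv (invariant-n< inv eout) (east⇒e∈ u∈ eout))
                      (ℕ.≤-trans le (ℕ.≤-reflexive (sym (ℕ.+-suc k j))))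
      in _ , q-e u∈ (inj₁ ia) q
    ... | inj₂ ob with ℕ.m≤n⇒m<n∨m≡n (proj₂ (mono _ u∈)) | e (suc i , j) ∈λ? la
    ... | inj₂ eq | _ =
      let (Q , q) = q-exists k i j (invariant-n inv (sym eq)) (ℕ.≤-pred (ℕ.≤-trans (ℕ.≤-reflexive (sym (ℕ.+-suc (part la 1) i))) le))
      in _ , q-n u∈ ob (trans (val-∈ u∈) (trans (cong just (sym eq)) (sym (val-n u∈)))) q
    ... | inj₁ n< | yes e∈ =
      let (Q , q) = q-exists k (suc i) (suc j) (invariant-e inv n< e∈) (ℕ.≤-trans le (ℕ.≤-reflexive (sym (ℕ.+-suc k j))))
      in _ , q-e u∈ (inj₂ (e∈ , subst₂ _<∞_ (sym (val-n u∈)) (sym (val-∈ u∈)) n<)) q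
    ... | inj₁ n< | no e∉ = _ , q-stop u∈ (subst₂ _<∞_ (sym (val-n u∈)) (sym (val-∈ u∈)) n<) e∉

    module Extracted {ω : Cell} {Q : List Cell} (path : Path π ω v Q) where

      π′ : Filling
      π′ = π -P Q

      strict⇒≤ : ∀ {x} y → x ∈ Q → V π y < V π x → V π′ y ≤ V π′ x
      strict⇒≤ y x∈ lt = ℕ.≤-trans (V-P-≤ Q y) (ℕ.≤-trans (ℕ.<⇒≤pred lt)
        (ℕ.≤-reflexive (sym (V-P-∈ x∈))))

      both⇒≤ : ∀ {x y} → x ∈ Q → y ∈ Q → V π y ≤ V π x → V π′ y ≤ V π′ x
      both⇒≤ x∈ y∈ le = subst₂ _≤_ (sym (V-P-∈ y∈)) (sym (V-P-∈ x∈)) (ℕ.∸-monoˡ-≤ 1 le)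

      both⇒≡ : ∀ {x y} → x ∈ Q → y ∈ Q → V π y ≡ V π x → V π′ y ≡ V π′ x
      both⇒≡ x∈ y∈ eq = trans (V-P-∈ y∈) (trans (cong (_∸ 1) eq) (sym (V-P-∈ x∈)))

      -- Lowering `x` is harmless if the neighbour is lowered too or was strictly smaller. After a
      -- north move from `y` to `x`, the west neighbour of `x` is `n (w y)`, which is strictly
      -- smaller by the inequality kept along the path.
      extracted-mono : Mono π′
      extracted-mono x x∈λ with x ∈? Q
      ... | no x∉ = ≤x (w x) (proj₁ (mono x x∈λ)) , ≤x (n x) (proj₂ (mono x x∈λ))
        where
        ≤x : ∀ y → V π y ≤ V π x → V π′ y ≤ V π′ x
        ≤x y le = ℕ.≤-trans (V-P-≤ Q y) (ℕ.≤-trans le (ℕ.≤-reflexive (sym (V-P-∉ x∉))))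
      ... | yes x∈ = west (path-entry path x∈) , north′ (path-exit path x∈)
        where
        west : Entry {π} {ω} Q v x → V π′ (w x) ≤ V π′ x
        west (inj₁ refl) = strict⇒≤ (w x) x∈ (proj₁ (proj₂ (proj₂ cand)))
        west (inj₂ (inj₁ (y , refl , y∈ , _ , _ , nw< , n≡))) = strict⇒≤ (w x) x∈ (subst (V π (n (w y)) <_) n≡ nw<)
        west (inj₂ (inj₂ (z , refl , z∈ , _))) = both⇒≤ x∈ z∈ (proj₁ (mono x x∈λ))
        north′ : Exit {π} {ω} Q x → V π′ (n x) ≤ V π′ x
        north′ (inj₁ (n∈Q , _)) = both⇒≤ x∈ n∈Q (proj₂ (mono x x∈λ))
        north′ (inj₂ (n< , _))  = strict⇒≤ (n x) x∈ n<

      north-in : ∀ {u} → u ∈ Q → n u ∈ Q → NorthOut u → V π u ≡ V π (n u) →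
        (InB la (n u) ⊎ InI la (n u)) × val la π′ (n u) ≡ val la π′ u
      north-in u∈ n∈Q nout n≡ = northIn⇒InBI (path-∈ path n∈Q) (northOut⇒northIn-n (path-∈ path u∈) nout) ,
        trans (val-∈ (path-∈ path n∈Q)) (trans (cong just (both⇒≡ u∈ n∈Q (sym n≡))) (sym (val-∈ (path-∈ path u∈))))

      -- The cell `s (e z)` shares its diagonal with `z`, so it is off the path and keeps its value
      -- while `e z` drops. Their values in `π′` therefore differ, and the insertion path turns
      -- west.
      east-in : ∀ {z} → z ∈ Q → e z ∈ Q → ¬ ((InB la (e z) ⊎ InI la (e z)) × val la π′ (e z) ≡ val la π′ (s (e z)))
      east-in {z} z∈ e∈Q (bi , eq) = ℕ.<-irrefl value-eq (ℕ.<-≤-trans smaller (proj₂ (mono (s (e z)) s∈)))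
        where
        e∈ = path-∈ path e∈Q
        s∈ = north⇒s∈ e∈ (InBI⇒northIn bi)
        content-se : content (s (e z)) ≡ content z
        content-se = trans (content-s (e z)) (trans (cong ℤ.pred (content-e z)) (ℤ.pred-suc _))
        s∉Q : ¬ s (e z) ∈ Q
        s∉Q s∈Q = ℕ.1+n≢n (cong proj₁ (path-unique path s∈Q z∈ content-se))
        value-eq : V π′ (e z) ≡ V π (s (e z))
        value-eq = trans (just-injective (trans (sym (val-∈ e∈)) (trans eq (val-∈ s∈)))) (V-P-∉ {π} s∉Q)
        smaller : V π′ (e z) < V π (e z)
        smaller = subst (_< V π (e z)) (sym (V-P-∈ {π} e∈Q)) (ℕ.∸-monoʳ-< (s≤s z≤n) (path-pos path e∈Q))

      ppath-start : ∀ {ρ u k P} → PPath la ρ u k P → u ∈ P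
      ppath-start (p-stop _)    = here refl
      ppath-start (p-s _ _ _)   = here refl
      ppath-start (p-w _ _ _)   = here refl

      -- `A` is the insertion path from the current cell, grown at its front while the remainder `R`
      -- of the extraction path is consumed. Only membership is tracked, since `_+P_` and
      -- `Compatible` depend on nothing else.
      reverse-path : ∀ {u R k A} → Path π ω u R → (∀ {x} → x ∈ R → x ∈ Q) →
        PPath la π′ u k A → (∀ {x} → x ∈ A → x ∈ Q) → (∀ {x} → x ∈ Q → x ∈ A ⊎ x ∈ R) →
        ∃₂ λ l P → suc l ≡ k + length R × PPath la π′ ω l P × (∀ {x} → x ∈ P → x ∈ Q) × (∀ {x} → x ∈ Q → x ∈ P)
      reverse-path {k = k} {A} (stop _ _ _) R⊆ pp A⊆ ⊆AR = k , A , sym (ℕ.+-comm k 1) , pp , A⊆ , ⊆A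
        where
        ⊆A : ∀ {x} → x ∈ Q → x ∈ A
        ⊆A x∈ with ⊆AR x∈
        ... | inj₁ x∈A         = x∈A
        ... | inj₂ (here refl) = ppath-start pp
      reverse-path {k = k} {A} (north {suc i , j} {P} u∈λ nout nw< n≡ p) R⊆ pp A⊆ ⊆AR =
        let (l , P′ , eq , r) = reverse-path p (R⊆ ∘ there) (p-s (path-∈ path n∈Q) (north-in u∈ n∈Q nout n≡) pp) ⊆₁ ⊆₂
        in l , P′ , trans eq (sym (ℕ.+-suc k (length P))) , r
        where
        u∈ = R⊆ (here refl)
        n∈Q = R⊆ (there (path-start p))
        ⊆₁ : ∀ {x} → x ∈ (i , j) ∷ A → x ∈ Q
        ⊆₁ (here refl) = n∈Q
        ⊆₁ (there x∈)  = A⊆ x∈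
        ⊆₂ : ∀ {x} → x ∈ Q → x ∈ (i , j) ∷ A ⊎ x ∈ P
        ⊆₂ x∈ with ⊆AR x∈
        ... | inj₁ x∈A         = inj₁ (there x∈A)
        ... | inj₂ (here refl) = inj₁ (there (ppath-start pp))
        ... | inj₂ (there x∈P) = inj₂ x∈P
      reverse-path {k = k} {A} (east {u} {P} u∈λ n< e∈ p) R⊆ pp A⊆ ⊆AR =
        let (l , P′ , eq , r) = reverse-path p (R⊆ ∘ there) (p-w (path-∈ path e∈Q) (east-in u∈ e∈Q) pp) ⊆₁ ⊆₂
        in l , P′ , trans eq (sym (ℕ.+-suc k (length P))) , r
        where
        u∈ = R⊆ (here refl)
        e∈Q = R⊆ (there (path-start p))
        ⊆₁ : ∀ {x} → x ∈ e u ∷ A → x ∈ Q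
        ⊆₁ (here refl) = e∈Q
        ⊆₁ (there x∈)  = A⊆ x∈
        ⊆₂ : ∀ {x} → x ∈ Q → x ∈ e u ∷ A ⊎ x ∈ P
        ⊆₂ x∈ with ⊆AR x∈
        ... | inj₁ x∈A         = inj₁ (there x∈A)
        ... | inj₂ (here refl) = inj₁ (there (ppath-start pp))
        ... | inj₂ (there x∈P) = inj₂ x∈P

      reversed : ∃ λ P → PPath la π′ ω (pathLength Q) P × (∀ {x} → x ∈ P → x ∈ Q) × (∀ {x} → x ∈ Q → x ∈ P)
      reversed =
        let (l , P , eq , pp , r) = reverse-path path (λ x∈ → x∈) (p-stop (proj₁ cand)) (λ { (here refl) → path-start path }) inj₂
        in P , subst (λ k → PPath la π′ ω k P) (cong (_∸ 1) eq) pp , r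

      -- The path meets each diagonal at most once, so a vertical pair in it comes from a north
      -- move, which preserves the value. On diagonals left eastwards it must move east, where π is
      -- flat.
      compatible : ∀ {P} → (∀ {x} → x ∈ P → x ∈ Q) → (∀ {x} → x ∈ Q → x ∈ P) → Compatible la P π′
      compatible {P} P⊆ ⊆P = horizontal , vertical
        where
        val-≡ : ∀ {x y} → x ∈ Q → y ∈ Q → V π x ≡ V π y → val la π′ x ≡ val la π′ y
        val-≡ x∈ y∈ eq = trans (val-∈ (path-∈ path x∈)) (trans (cong just (both⇒≡ y∈ x∈ eq)) (sym (val-∈ (path-∈ path y∈))))
        horizontal : ∀ u → u ∈ P → InI la u ⊎ InA la u → e u ∈ P × val la π′ u ≡ val la π′ (e u)
        horizontal u u∈P ia with path-exit path (P⊆ u∈P)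
        ... | inj₁ (_ , nout , _)      = ⊥-elim (east-north-exclusive (InIA⇒eastOut ia) nout)
        ... | inj₂ (_ , inj₂ e∉)       = ⊥-elim (e∉ (east⇒e∈ (path-∈ path (P⊆ u∈P)) (InIA⇒eastOut ia)))
        ... | inj₂ (_ , inj₁ e∈Q)      = ⊆P e∈Q ,
          val-≡ (P⊆ u∈P) e∈Q (flat-e (path-∈ path (P⊆ u∈P)) (InIA⇒eastOut ia) (path-content path (P⊆ u∈P)))
        vertical : ∀ u → u ∈ P → s u ∈ P → val la π′ u ≡ val la π′ (s u)
        vertical u u∈P s∈P with path-entry path (P⊆ u∈P)
        ... | inj₁ refl = ⊥-elim (ℤ.<⇒≱ (subst (ℤ._< content u) (sym (content-s u)) (pred< _)) (path-content path (P⊆ s∈P)))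
        ... | inj₂ (inj₁ ((suc i , j) , refl , _ , _ , _ , _ , n≡)) = val-≡ (P⊆ u∈P) (P⊆ s∈P) (sym n≡)
        ... | inj₂ (inj₂ (z , refl , z∈ , _)) = ⊥-elim (ℕ.1+n≢n (cong proj₁ (path-unique path (P⊆ s∈P) z∈
                (trans (content-s (e z)) (trans (cong ℤ.pred (content-e z)) (ℤ.pred-suc _))))))

      restored : ∀ {P} → (∀ {x} → x ∈ P → x ∈ Q) → (∀ {x} → x ∈ Q → x ∈ P) → π ≈[ la ] (π′ +P P)
      restored {P} P⊆ ⊆P u u∈ with u ∈? Q
      ... | yes u∈Q = sym (begin
        (π′ +P P) u     ≡⟨ +P-∈ π′ u (⊆P u∈Q) ⟩
        suc (π′ u)      ≡⟨ cong suc (-P-∈ π u u∈Q) ⟩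
        suc (π u ∸ 1)   ≡⟨ ℕ.m+[n∸m]≡n (subst (0 <_) (V≡π u∈) (path-pos path u∈Q)) ⟩
        π u             ∎)
        where open ≡-Reasoning
      ... | no u∉Q = sym (trans (+P-∉ π′ u (u∉Q ∘ P⊆)) (-P-∉ π u u∉Q))

      insert : ∀ {h} → ω ≡ hookTail la h → pathLength Q ≡ hookLength la h → Insert la h π′ π
      insert {h} refl len with reversed
      ... | P , pp , P⊆ , ⊆P rewrite len =
        (P , ppath⇒sw pp , ppath-head pp , cong (_∸ 1) (ppath-length pp) , compatible P⊆ ⊆P , rpp-cong (restored P⊆ ⊆P) (mono⇒rpp mono)) ,
        P , pp , restored P⊆ ⊆P
        where
        ppath-head : ∀ {ρ u k P} → PPath la ρ u k P → head P ≡ just u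
        ppath-head (p-stop _)    = refl
        ppath-head (p-s _ _ _)   = refl
        ppath-head (p-w _ _ _)   = refl
        ppath-length : ∀ {ρ u k P} → PPath la ρ u k P → length P ≡ suc k
        ppath-length (p-stop _)    = refl
        ppath-length (p-s _ _ p)   = cong suc (ppath-length p)
        ppath-length (p-w _ _ p)   = cong suc (ppath-length p)
        sw-south : ∀ {u P} → u ∈λ la → head P ≡ just (s u) → SWPath la P → SWPath la (u ∷ P)
        sw-south {P = _ ∷ _} u∈ refl p = sw-s u∈ p
        sw-west : ∀ {u P} → u ∈λ la → head P ≡ just (w u) → SWPath la P → SWPath la (u ∷ P)
        sw-west {P = _ ∷ _} u∈ refl p = sw-w u∈ p
        ppath⇒sw : ∀ {ρ u k P} → PPath la ρ u k P → SWPath la P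
        ppath⇒sw (p-stop u∈)    = sw-one u∈
        ppath⇒sw (p-s u∈ _ p)   = sw-south u∈ (ppath-head p) (ppath⇒sw p)
        ppath⇒sw (p-w u∈ _ p)   = sw-west u∈ (ppath-head p) (ppath⇒sw p)

  -- Existence of minimal candidates.

  ∈-cells : ∀ {u} → u ∈λ la → u ∈ cells la
  ∈-cells {suc i , suc j} (_ , 1≤j , j<) = ∈-concatMap⁺ row
    (lose (∈-map⁺ suc (∈-upTo⁺ (part-bound la (suc i) (ℕ.≤-trans 1≤j j<)))) (∈-map⁺ (suc i ,_) (∈-map⁺ suc (∈-upTo⁺ j<))))

  candidate? : ∀ π → Decidable (Candidate π)
  candidate? π u with u ∈λ? la
  ... | no u∉ = no (u∉ ∘ proj₁)
  ... | yes u∈ with eastIn-or-northIn u∈ | V π (w u) ℕ.<? V π u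
  ... | inj₂ nin | _      = no (λ (_ , ein , _) → east-north-exclusive ein nin)
  ... | inj₁ _   | no ≮   = no (λ (_ , _ , w< , _) → ≮ w<)
  ... | inj₁ ein | yes w< with eastOut-or-northOut u∈ | V π (n u) ℕ.<? V π u
  ... | inj₂ nout | _      = yes (u∈ , ein , w< , inj₁ nout)
  ... | inj₁ _    | yes n< = yes (u∈ , ein , w< , inj₂ n<)
  ... | inj₁ eout | no ≮   = no λ { (_ , _ , _ , inj₁ nout) → east-north-exclusive eout nout ; (_ , _ , _ , inj₂ n<) → ≮ n< }

  -- Without candidates, the value of a cell is bounded by that of a cell of smaller content.
  no-candidate⇒zero : ∀ {π} → Mono π → (∀ u → ¬ Candidate π u) →
    ∀ k i j → (i , j) ∈λ la → length la + j ≤ k + i → V π (i , j) ≡ 0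
  no-candidate⇒zero mono none zero i j (_ , 1≤j , j≤) le =
    contradiction (ℕ.≤-trans (ℕ.m<m+n (length la) 1≤j) le) (ℕ.≤⇒≯ (part-bound la i (ℕ.≤-trans 1≤j j≤)))
  no-candidate⇒zero {π} mono none (suc k) i (suc j) u∈ le with eastIn-or-northIn u∈
  ... | inj₂ nin = ℕ.n≤0⇒n≡0 (ℕ.≤-trans (proj₂ (mono _ (north⇒s∈ u∈ nin)))
          (ℕ.≤-reflexive (no-candidate⇒zero mono none k (suc i) (suc j) (north⇒s∈ u∈ nin)
            (ℕ.≤-trans le (ℕ.≤-reflexive (sym (ℕ.+-suc k i)))))))
  -- In the absence of candidates any bound below the content of the cell makes flatness available.
  ... | inj₁ ein = trans (sym (Flat.flat {c = ℤ.pred (content (i , suc j))} mono (λ u c → contradiction c (none u)) i (suc j) u∈ ein (pred< _)))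
          (west j u∈ (ℕ.≤-pred (ℕ.≤-trans (ℕ.≤-reflexive (sym (ℕ.+-suc (length la) j))) le)))
    where
    west : ∀ j → (i , suc j) ∈λ la → length la + j ≤ k + i → V π (i , j) ≡ 0
    west zero    _  _  = V-column-zero π i
    west (suc j) u∈ le = no-candidate⇒zero mono none k i (suc j) (w∈ u∈) le

  zero-or-candidate : ∀ {π} → Mono π → IsZero la π ⊎ (∃ λ v → Candidate π v × (∀ u → Candidate π u → v ⊴ u))
  zero-or-candidate {π} mono with ⊴-minimum (candidate? π) (cells la)
  ... | inj₂ (v , cand , min) = inj₂ (v , cand , λ u c → min (∈-cells (proj₁ c)) c)
  ... | inj₁ none = inj₁ λ u u∈ → trans (sym (V≡π u∈))
          (no-candidate⇒zero mono (λ u c → none (∈-cells (proj₁ c)) c) (length la + proj₂ u) (proj₁ u) (proj₂ u) u∈ (ℕ.m≤m+n _ _))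

  candidate⇒nonzero : ∀ {π v} → Candidate π v → ¬ IsZero la π
  candidate⇒nonzero {π} {v} (v∈ , _ , w< , _) zero-π = ℕ.n≮0 (subst (V π (w v) <_) (trans (V≡π v∈) (zero-π _ v∈)) w<)

  -- Rim-hooks of extraction paths.

  path-pathLength : ∀ {π ω u Q} → Path π ω u Q → proj₂ ω + proj₁ u ≡ pathLength Q + (proj₁ ω + proj₂ u)
  path-pathLength p@(stop _ _ _)      = ℕ.suc-injective (path-length p)
  path-pathLength p@(north _ _ _ _ _) = ℕ.suc-injective (path-length p)
  path-pathLength p@(east _ _ _ _)    = ℕ.suc-injective (path-length p)

  hookTail-row : ∀ {π ω u Q} → Path π ω u Q → ω ≡ (proj₁ ω , part la (proj₁ ω))
  hookTail-row {ω = a , b} p with path-end p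
  ... | (1≤a , _ , b≤) , e∉ with ℕ.m≤n⇒m<n∨m≡n b≤
  ... | inj₁ lt = contradiction (1≤a , s≤s z≤n , lt) e∉
  ... | inj₂ eq = cong (a ,_) eq

  -- The diagonal of `v` is entered eastwards from `(c , l)`, so its rim cell `(c , suc l)` is the
  -- bottom of a column and can be a head. The row of `ω` and the column `suc l` then index the
  -- hook.
  hook-exists : ∀ {π ω v Q} → v ∈λ la → EastIn v → Path π ω v Q →
    ∃ λ h → h ∈λ la × ω ≡ hookTail la h × pathLength Q ≡ hookLength la h
  hook-exists {ω = a , b} {v = i , j} (1≤i , 1≤j , j≤) (c , l , 1≤c , lo , hi , eq) p =
    (a , suc l) , (1≤a , s≤s z≤n , l<) , hookTail-row p ,
    trans (diagonal⇒length i j _ a≤conj l<b (path-pathLength p) diag′)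
      (cong (λ t → (conjPart la (suc l) ∸ a) + (t ∸ suc l)) (cong proj₂ (hookTail-row p)))
    where
    1≤a = proj₁ (proj₁ (path-end p))
    diag : suc l + i ≡ j + c
    diag = sym (⊖-≡⁻ j i (suc l) c (trans (sym (ℤ.suc-pred (j ⊖ i))) (trans (cong ℤ.suc (sym eq)) (sym (content-e (c , l))))))
    i≤c : i ≤ c
    i≤c = ℕ.≮⇒≥ λ c<i → ℕ.<⇒≢ (ℕ.+-mono-≤-< (ℕ.≤-trans j≤ (ℕ.≤-trans (part-anti (s≤s z≤n) c<i) (ℕ.≤-trans lo (ℕ.n≤1+n l)))) c<i) (sym diag)
    a≤c = ℕ.≤-trans (path-row p) i≤c
    l< : suc l ≤ part la a
    l< = ℕ.≤-trans hi (part-anti 1≤a a≤c)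
    l<b : suc l ≤ b
    l<b = subst (suc l ≤_) (sym (cong proj₂ (hookTail-row p))) l<
    conj≡ : conjPart la (suc l) ≡ c
    conj≡ = ℕ.≤-antisym
      (ℕ.≮⇒≥ λ lt → ℕ.<⇒≱ (s≤s lo) (≤conj⇒≤part la ip (suc c) (suc l) (s≤s z≤n) lt))
      (≤part⇒≤conj la ip c (suc l) (s≤s z≤n) hi)
    a≤conj = ℕ.≤-trans a≤c (ℕ.≤-reflexive (sym conj≡))
    diag′ : j + conjPart la (suc l) ≡ suc l + i
    diag′ = trans (cong (λ t → j + t) conj≡) (sym diag)

  -- Equal tails and equal lengths put the two starting points on one diagonal; this translates
  -- columns of hooks into contents of candidates.
  hook-content : ∀ {π ω v Q h} → h ∈λ la → Path π ω v Q → ω ≡ hookTail la h → pathLength Q ≡ hookLength la h →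
    content v ≡ content (hookHead la h)
  hook-content {v = i , j} {h = a , l} (1≤a , 1≤l , l≤) p refl len =
    ℤ.≤-antisym (⊖-≤⁺ j i l (conjPart la l) (ℕ.≤-reflexive eq)) (⊖-≤⁺ l (conjPart la l) j i (ℕ.≤-reflexive (sym eq)))
    where eq = length⇒diagonal i j _ (≤part⇒≤conj la ip a l 1≤l l≤) l≤ (path-pathLength p) len

  conj-antitone : ∀ {j l} → 1 ≤ j → j ≤ l → conjPart la l ≤ conjPart la j
  conj-antitone {j} {l} 1≤j j≤l with conjPart la l in eq
  ... | zero  = z≤n
  ... | suc c = ≤part⇒≤conj la ip (suc c) j 1≤j
                  (ℕ.≤-trans j≤l (≤conj⇒≤part la ip (suc c) l (s≤s z≤n) (ℕ.≤-reflexive (sym eq))))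

  hookHead-< : ∀ {h k} → 1 ≤ proj₂ h → proj₂ h < proj₂ k → content (hookHead la h) ℤ.< content (hookHead la k)
  hookHead-< {i , j} {k , l} 1≤j j<l = ⊖-<⁺ j (conjPart la j) l (conjPart la l) (ℕ.+-mono-<-≤ j<l (conj-antitone 1≤j (ℕ.<⇒≤ j<l)))

  -- The order of successive rim-hooks.

  record MinimalCandidate (π : Filling) (v : Cell) : Set where
    constructor minimal
    field
      candidate : Candidate π v
      least     : ∀ u → Candidate π u → v ⊴ u

    above : NoCandidateAbove π (content v)
    above u c with least u c
    ... | inj₁ lt       = ℤ.<⇒≤ lt
    ... | inj₂ (eq , _) = ℤ.≤-reflexive (sym eq)

    lowest : ∀ u → Candidate π u → content u ≡ content v → proj₁ u ≤ proj₁ v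
    lowest u c eq with least u c
    ... | inj₁ lt       = ⊥-elim (ℤ.<-irrefl eq lt)
    ... | inj₂ (_ , le) = le

  -- A cell strictly south-east of `v` on its diagonal would force `e v` into the shape.
  row-end-south-east : ∀ {u v} → u ∈λ la → v ∈λ la → ¬ e v ∈λ la → content u ≡ content v → proj₁ v ≤ proj₁ u → u ≡ v
  row-end-south-east {i , j} {k , l} (_ , _ , j≤) (1≤k , _ , _) e∉ eq k≤i with ℕ.m≤n⇒m<n∨m≡n k≤i
  ... | inj₂ refl = same-diagonal eq refl
  ... | inj₁ k<i  = contradiction (1≤k , s≤s z≤n , ℕ.≤-trans l<j (ℕ.≤-trans j≤ (part-anti 1≤k k≤i))) e∉
    where
    l<j : l < j
    l<j = ℕ.+-cancelʳ-< k l j (ℕ.<-≤-trans (ℕ.+-monoʳ-< l k<i) (ℕ.≤-reflexive (sym (⊖-≡⁻ j i l k eq))))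

  module Next {π : Filling} {v ω : Cell} {Q : List Cell} (mono : Mono π) (min : MinimalCandidate π v) (path : Path π ω v Q) where
    open MinimalCandidate min
    open Flat mono above
    open Extract.Extracted mono candidate above path

    -- Beyond c(v), π agrees at `w x` and `x`. If `w x` is off the path, `x` cannot rise above it;
    -- if it is on the path, the path continues to `x` and both values drop.
    next-content : ∀ x → Candidate π′ x → content x ℤ.≤ content v
    next-content x@(i , suc j) (x∈λ , ein , w< , _) = ℤ.≮⇒≥ λ lt → go lt (w x ∈? Q)
      where
      go : content v ℤ.< content x → Dec (w x ∈ Q) → ⊥
      go lt (no w∉)  = ℕ.<-irrefl (flat i (suc j) x∈λ ein lt)
        (ℕ.<-≤-trans (subst (_< V π′ x) (V-P-∉ {π} w∉) w<) (V-P-≤ {π} Q x))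
      go lt (yes w∈Q) with path-exit path w∈Q
      ... | inj₁ (_ , nout , _) = east-north-exclusive (subst EastStep (sym (content-w x (s≤s z≤n))) ein) nout
      ... | inj₂ (_ , inj₂ e∉)  = e∉ x∈λ
      ... | inj₂ (_ , inj₁ x∈Q) = ℕ.<-irrefl (both⇒≡ x∈Q w∈Q (flat i (suc j) x∈λ ein lt)) w<

    -- If `x` lay below `v`, its strict inequality towards the west would already hold in π. As `x`
    -- is no candidate of π, its north neighbour has the same value in π and must have been lowered,
    -- hence lies on the path.
    next-row : ∀ x → Candidate π′ x → content x ≡ content v → proj₁ x ≤ proj₁ v
    next-row x@(suc i , suc j) (x∈λ , ein , w<′ , alt) eq = ℕ.≮⇒≥ λ lt → below lt alt
      where
      w∉ : ¬ w x ∈ Q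
      w∉ w∈Q = ℤ.<⇒≱ (subst (ℤ._< content v) (sym (trans (content-w x (s≤s z≤n)) (cong ℤ.pred eq))) (pred< _)) (path-content path w∈Q)
      x∉ : proj₁ v < suc i → ¬ x ∈ Q
      x∉ lt x∈Q = ℕ.<⇒≢ lt (sym (cong proj₁ (path-unique path x∈Q (path-start path) eq)))
      w< : proj₁ v < suc i → V π (w x) < V π x
      w< lt = subst₂ _<_ (V-P-∉ {π} w∉) (V-P-∉ {π} (x∉ lt)) w<′
      on-diagonal : ∀ {y} → y ∈ Q → ℤ.suc (content y) ≡ content (n x) → y ≡ v
      on-diagonal {y} y∈ eq′ = path-unique path y∈ (path-start path)
        (trans (sym (ℤ.pred-suc _)) (trans (cong ℤ.pred (trans eq′ (content-n∈ x∈λ))) (trans (ℤ.pred-suc _) eq)))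
      entered : proj₁ v < suc i → EastOut x → V π (n x) ≡ V π x → Entry {π} {ω} Q v (n x) → ⊥
      entered lt eout n≡ (inj₁ n≡v) = ℤ.<-irrefl (cong content (sym n≡v))
        (subst (content v ℤ.<_) (sym (trans (content-n∈ x∈λ) (cong ℤ.suc eq))) (<suc _))
      entered lt eout n≡ (inj₂ (inj₁ (y , n≡n , y∈ , y∈λ , _)))
        with on-diagonal y∈ (trans (sym (content-n∈ y∈λ)) (cong content (sym n≡n)))
      ... | refl = ℕ.<⇒≱ (ℕ.∸-monoʳ-< (s≤s z≤n) (proj₁ y∈λ)) (subst (proj₁ v ≤_) (cong proj₁ n≡n) (ℕ.≤-pred lt))
      -- The path enters `n x` from `z = (i , j)`, where π is flat, and `w x` lies just south of
      -- `z`; so `w x` has at least the value of `x`.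
      entered lt eout n≡ (inj₂ (inj₂ ((.i , .j) , refl , z∈ , _))) = ℕ.<⇒≱ (w< lt)
        (ℕ.≤-trans (ℕ.≤-reflexive (trans (sym n≡) (sym (flat-e z∈λ eout-z (path-content path z∈)))))
          (proj₂ (mono (suc i , j) (s≤s z≤n , proj₁ (proj₂ z∈λ) , ℕ.<⇒≤ (proj₂ (proj₂ x∈λ))))))
        where
        z∈λ = path-∈ path z∈
        eout-z : EastOut (i , j)
        eout-z = subst EastStep (ℤ.[1+m]⊖[1+n]≡m⊖n j i) eout
      below : proj₁ v < suc i → NorthOut x ⊎ V π′ (n x) < V π′ x → ⊥
      below lt (inj₁ nout) = ℕ.<⇒≱ lt (lowest x (x∈λ , ein , w< lt , inj₁ nout) eq)
      below lt (inj₂ n<′) with ℕ.m≤n⇒m<n∨m≡n (proj₂ (mono x x∈λ)) | eastOut-or-northOut x∈λ | n x ∈? Q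
      ... | inj₁ n< | _         | _       = ℕ.<⇒≱ lt (lowest x (x∈λ , ein , w< lt , inj₂ n<) eq)
      ... | inj₂ _  | inj₂ nout | _       = ℕ.<⇒≱ lt (lowest x (x∈λ , ein , w< lt , inj₁ nout) eq)
      ... | inj₂ n≡ | inj₁ _    | no n∉   = ℕ.<-irrefl n≡ (subst₂ _<_ (V-P-∉ {π} n∉) (V-P-∉ {π} (x∉ lt)) n<′)
      ... | inj₂ n≡ | inj₁ eout | yes n∈Q = entered lt eout n≡ (path-entry path n∈Q)

    stays-equal : ∀ {u} → u ∈ Q → n u ∈ Q → V π u ≡ V π (n u) → ¬ V π′ (n u) < V π′ u
    stays-equal u∈ n∈Q n≡ n< = ℕ.<-irrefl (both⇒≡ u∈ n∈Q (sym n≡)) n<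

    -- The later path stays weakly north-west of the earlier one.
    row-decreases : ∀ {u u′ ω′ R R′} → Path π ω u R → (∀ {x} → x ∈ R → x ∈ Q) → Path π′ ω′ u′ R′ →
      content u ≡ content u′ → proj₁ u′ ≤ proj₁ u → proj₁ ω′ ≤ proj₁ ω
    row-decreases (stop _ _ _) R⊆ p′ eq le = ℕ.≤-trans (path-row p′) le
    -- The later path stops at a row end, so both paths are at the same cell. Its equality with the
    -- north neighbour survives the extraction and contradicts stopping.
    row-decreases (north u∈ _ _ n≡ p) R⊆ (stop u′∈ n< e∉) eq le with row-end-south-east u∈ u′∈ e∉ eq le
    ... | refl = ⊥-elim (stays-equal (R⊆ (here refl)) (R⊆ (there (path-start p))) n≡ n<)
    row-decreases (east u∈ _ e∈ p) R⊆ (stop u′∈ n< e∉) eq le with row-end-south-east u∈ u′∈ e∉ eq le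
    ... | refl = ⊥-elim (e∉ e∈)
    row-decreases (north u∈ _ _ _ p) R⊆ (north u′∈ _ _ _ p′) eq le =
      row-decreases p (R⊆ ∘ there) p′ (trans (content-n∈ u∈) (trans (cong ℤ.suc eq) (sym (content-n∈ u′∈)))) (ℕ.∸-monoˡ-≤ 1 le)
    row-decreases (east {u} u∈ _ _ p) R⊆ (east {u′} u′∈ _ _ p′) eq le =
      row-decreases p (R⊆ ∘ there) p′ (trans (content-e u) (trans (cong ℤ.suc eq) (sym (content-e u′)))) le
    row-decreases (east {u} u∈ _ _ p) R⊆ (north {u′} u′∈ _ _ _ p′) eq le =
      row-decreases p (R⊆ ∘ there) p′ (trans (content-e u) (trans (cong ℤ.suc eq) (sym (content-n∈ u′∈)))) (ℕ.≤-trans (ℕ.m∸n≤m _ 1) le)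
    -- The only pair of moves by which the later path could pass below the earlier one; this would
    -- need a common cell, where the surviving equality forbids an east move.
    row-decreases (north {u} u∈ _ _ n≡ p) R⊆ (east {u′} u′∈ n< _ p′) eq le with ℕ.m≤n⇒m<n∨m≡n le
    ... | inj₁ lt = row-decreases p (R⊆ ∘ there) p′ (trans (content-n∈ u∈) (trans (cong ℤ.suc eq) (sym (content-e u′)))) (ℕ.<⇒≤pred lt)
    ... | inj₂ same with same-diagonal {u} {u′} eq (sym same)
    ... | refl = ⊥-elim (stays-equal (R⊆ (here refl)) (R⊆ (there (path-start p))) n≡ n<)

    -- Columns compare like the contents of the two candidates, and rows like the ends of the two
    -- paths.
    hook-≤ : ∀ {v′ ω′ Q′ h h′} → Candidate π′ v′ → Path π′ ω′ v′ Q′ →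
      h ∈λ la → ω ≡ hookTail la h → pathLength Q ≡ hookLength la h →
      h′ ∈λ la → ω′ ≡ hookTail la h′ → pathLength Q′ ≡ hookLength la h′ → h ≤rl h′
    hook-≤ {v′} {h = i , j} {i′ , j′} cand′ path′ h∈ tail len h′∈ tail′ len′ with ℕ.<-cmp j j′
    ... | tri> _ _ j>j′ = inj₁ j>j′
    ... | tri< j<j′ _ _ = ⊥-elim (ℤ.<⇒≱
            (subst₂ ℤ._<_ (sym (hook-content h∈ path tail len)) (sym (hook-content h′∈ path′ tail′ len′))
              (hookHead-< {i , j} {i′ , j′} (proj₁ (proj₂ h∈)) j<j′))
            (next-content v′ cand′))
    ... | tri≈ _ refl _ = inj₂ (refl , subst₂ _≤_ (cong proj₁ tail′) (cong proj₁ tail)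
            (row-decreases path (λ x∈ → x∈) path′ (sym same) (next-row v′ cand′ same)))
      where same = trans (hook-content h′∈ path′ tail′ len′) (sym (hook-content h∈ path tail len))

  min-cand : ∀ {π v} → Cand la π v → (∀ u → Cand la π u → v ⊴ u) → MinimalCandidate π v
  min-cand cand least = minimal (cand⇒candidate cand) (λ u c → least u (candidate⇒cand c))

  -- The recursion is on a bound for the sum of the entries, which falls because the positive entry
  -- at `v` is lowered.
  run-exists : ∀ k {π} → Mono π → sum (map π (cells la)) ≤ k → ∃ λ hs → Run la π hs
  run-exists k {π} mono le with zero-or-candidate mono
  ... | inj₁ zero-π = [] , run-done zero-π
  ... | inj₂ (v , cand , least) = continue k le
    where
    open MinimalCandidate (minimal cand least) using (above)
    open Extract mono cand above
    Q = proj₁ (q-exists (part la 1 + proj₁ v) (proj₁ v) (proj₂ v) invariant-start (ℕ.m≤m+n _ _))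
    q = proj₂ (q-exists (part la 1 + proj₁ v) (proj₁ v) (proj₂ v) invariant-start (ℕ.m≤m+n _ _))
    path = proj₂ (q⇒path invariant-start q)
    open Extracted path
    smaller : sum (map π′ (cells la)) < sum (map π (cells la))
    smaller = sum-map-< {f = π′} {g = π} decreasing (∈-cells (proj₁ cand)) strict
      where
      decreasing : ∀ x → π′ x ≤ π x
      decreasing x with x ∈? Q
      ... | yes x∈ = ℕ.≤-trans (ℕ.≤-reflexive (-P-∈ π x x∈)) (ℕ.m∸n≤m _ 1)
      ... | no x∉  = ℕ.≤-reflexive (-P-∉ π x x∉)
      strict : π′ v < π v
      strict = subst (_< π v) (sym (-P-∈ π v (path-start path)))
        (ℕ.∸-monoʳ-< (s≤s z≤n) (subst (0 <_) (V≡π (proj₁ cand)) (path-pos path (path-start path))))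
    continue : ∀ k → sum (map π (cells la)) ≤ k → ∃ λ hs → Run la π hs
    continue zero    le = contradiction (ℕ.<-≤-trans smaller le) ℕ.n≮0
    continue (suc k) le =
      let (h , h∈ , tail , len) = hook-exists (proj₁ cand) (proj₁ (proj₂ cand)) path
          (hs , run) = run-exists k extracted-mono (ℕ.≤-pred (ℕ.<-≤-trans smaller le))
      in h ∷ hs , run-step (candidate⇒nonzero cand) (candidate⇒cand cand) (λ u c → least u (cand⇒candidate c)) q h∈
           (trans (path-last path) (cong just tail)) len run

  run⇒ : ∀ {π hs} → Mono π → Run la π hs → Linked _≤rl_ hs × IterInsert la hs π
  run⇒ mono (run-done zero-π) = [] , ii-nil zero-π
  run⇒ {π} mono (run-step {v = v} {Q = Q} {h = h} {hs} _ cand least q h∈ lst len run) =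
    link run (proj₁ rec) , ii-cons (proj₂ rec) (insert tail len)
    where
    min = min-cand cand least
    open MinimalCandidate min
    open Extract mono candidate above
    path = proj₂ (q⇒path invariant-start q)
    tail = just-injective (trans (sym (path-last path)) lst)
    open Extracted path
    rec = run⇒ extracted-mono run
    link : ∀ {hs} → Run la π′ hs → Linked _≤rl_ hs → Linked _≤rl_ (h ∷ hs)
    link (run-done _) [] = [-]
    link (run-step _ cand′ least′ q′ h′∈ lst′ len′ _) linked =
      Next.hook-≤ mono min path (MinimalCandidate.candidate min′) path′ h∈ tail len h′∈
        (just-injective (trans (sym (path-last path′)) lst′)) len′ ∷ linked
      where
      min′ = min-cand cand′ least′
      open Extract extracted-mono (MinimalCandidate.candidate min′) (MinimalCandidate.above min′)
        using () renaming (invariant-start to start′; q⇒path to q⇒path′)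
      path′ = proj₂ (q⇒path′ start′ q′)

mainTheorem15 : (la : Partition) → IsPartition la →
    (π : Filling) → IsRPP la π →
    (Σ (List Cell) (λ hs → Run la π hs))
    × (∀ hs → Run la π hs → Linked _≤rl_ hs × IterInsert la hs π)
mainTheorem15 la ip π rpp = run-exists (sum (map π (cells la))) (rpp⇒mono rpp) ℕ.≤-refl , λ hs → run⇒ (rpp⇒mono rpp)
  where
  open Shape la ip
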